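{- Breadth-First Search for undirected graphs is in $\mathsf{DynFO}$. Explicitly: there is a finite relational vocabulary $\tau$ containing relation symbols $Edge(x,y)$, $O(x,y)$, $Level(v,x,l)$, $BFSEdge(v,x,y)$, $Path(v,x,y,z)$ (and finitely many further auxiliary relation symbols), and there are first-order formulas over $\tau$ (with two additional parameters $a,b$ naming the endpoints of the changed edge), not depending on the number of vertices, one for each relation symbol and each of the two request types $insert(a,b)$ and $delete(a,b)$ ($a\neq b$), such that the following holds. For every finite vertex set $V$, start with the edgeless undirected graph on $V$ and all relations of $\tau$ empty, apply any finite sequence of edge insertions and edge deletions, and after each request $insert(a,b)$ or $delete(a,b)$ replace each relation by the relation defined (on the previous $\tau$-structure with domain $V$) by the corresponding formula. Then at every stage, where $G$ is the current graph and $U\subseteq V$ is the set of vertices that have occurred in at least one insertion request so far: (i) $Edge$ is the (symmetric) edge relation of $G$; (ii) $O$ is a linear order on $U$; (iii) for all $v,x,l\in U$: $Level(v,x,l)$ holds if and only if $v$ and $x$ are connected in $G$ and their distance in $G$ equals the rank of $l$ in the order $O$; (iv) for every $v\in U$, the pairs $(x,y)$ with $BFSEdge(v,x,y)$ are exactly the (symmetrically listed) edges of a breadth-first search tree $T_v$ of $G$ rooted at $v$; (v) for all $v\in U$ and all $x,y,z$ in $T_v$: $Path(v,x,y,z)$ holds if and only if $z$ lies on the unique path from $x$ to $y$ in $T_v$. In particular, the distance between any two vertices, and the set of all vertices at a given distance from a given vertex, are first-order definable from the maintained relations.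
   Context: All graphs are finite, simple and undirected. $\mathsf{DynFO}$ (Patnaik-Immerman) is the class of dynamic problems for which one can maintain a polynomial-size auxiliary relational structure such that (1) the answer to the query is first-order definable from the auxiliary structure, (2) after each single-tuple insertion or deletion in the input the auxiliary structure can be updated by fixed first-order formulas evaluated on the old auxiliary structure and the request, and (3) the initial auxiliary structure, for the empty input, is first-order computable. A breadth-first search tree $T_v$ of $G$ rooted at $v$ is a spanning tree of the connected component of $v$ in $G$ such that, for each vertex $x$ in that component, the path from $v$ to $x$ in $T_v$ is a shortest path from $v$ to $x$ in $G$. Vertices not connected to $v$ do not appear in $T_v$. Numbers are encoded by vertices: the rank of $l\in U$ in the linear order $O$ is the number of elements of $U$ strictly smaller than $l$ (so the least element has rank $0$). -}

module Defs where

open import Level using (0ℓ)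
open import Data.Bool.Base using (Bool; false; T)
open import Data.Bool.Properties using (T?)
open import Data.Empty using (⊥)
open import Data.Fin.Base using (Fin)
open import Data.Fin.Properties using (_≟_; any?; all?)
open import Data.List.Base as List using (List; []; _∷_; foldr; filter; allFin)
open import Data.List.Membership.Propositional using (_∈_)
open import Data.List.Relation.Unary.Any as Any using (Any)
open import Data.List.Relation.Unary.Unique.Propositional using (Unique)
open import Data.Nat.Base as ℕ using (ℕ; suc; _+_)
open import Data.Product.Base using (Σ-syntax; ∃; ∃-syntax; _×_; _,_; proj₁)
open import Data.Sum.Base as Sum using (_⊎_; inj₁; inj₂)
open import Data.Unit.Base using (⊤; tt)
open import Data.Vec.Base as Vec using (Vec; []; _∷_)
open import Function.Base using (_on_; _∘_)
open import Function.Bundles using (_⇔_)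
open import Relation.Binary.Construct.Closure.ReflexiveTransitive using (Star; ε; _◅_)
open import Relation.Binary.Core using (Rel; _⇒_)
open import Relation.Binary.Definitions using (Symmetric)
open import Relation.Binary.PropositionalEquality.Core using (_≡_; _≢_; sym; trans)
open import Relation.Binary.Structures using (IsTotalOrder)
open import Relation.Nullary.Decidable.Core using (Dec; no; does; ¬?; _×-dec_; _⊎-dec_)
open import Relation.Nullary.Negation.Core using (¬_)
open import Relation.Unary as U using (Pred; _⊆_; _≐_)

------------------------------------------------------------------------
-- First-order logic with equality over finite relational structures

record Vocabulary : Set₁ where
  field
    Symbol : Set
    arity  : Symbol → ℕ

open Vocabulary public

-- Formula τ k: formulas with free variables among the k de Bruijn indices
-- in Fin k; a quantifier binds index zero.
data Formula (τ : Vocabulary) : ℕ → Set where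
  atom    : ∀ {k} (R : Symbol τ) → Vec (Fin k) (arity τ R) → Formula τ k
  _≈ᶠ_    : ∀ {k} → Fin k → Fin k → Formula τ k
  ¬ᶠ_     : ∀ {k} → Formula τ k → Formula τ k
  _∧ᶠ_    : ∀ {k} → Formula τ k → Formula τ k → Formula τ k
  _∨ᶠ_    : ∀ {k} → Formula τ k → Formula τ k → Formula τ k
  ∃ᶠ_ ∀ᶠ_ : ∀ {k} → Formula τ (suc k) → Formula τ k

-- Relations are Bool-valued, so that satisfaction is the classical one.
record Structure (τ : Vocabulary) (n : ℕ) : Set where
  field
    ⟦_⟧ : (R : Symbol τ) → Vec (Fin n) (arity τ R) → Bool

open Structure public

Holds : ∀ {τ n} → Structure τ n → (R : Symbol τ) → Vec (Fin n) (arity τ R) → Set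
Holds M R xs = T (⟦ M ⟧ R xs)

infix 4 _⊨_[_] _⊨?_[_]

_⊨_[_] : ∀ {τ n k} → Structure τ n → Formula τ k → Vec (Fin n) k → Set
M ⊨ atom R is [ ρ ] = Holds M R (Vec.map (Vec.lookup ρ) is)
M ⊨ i ≈ᶠ j    [ ρ ] = Vec.lookup ρ i ≡ Vec.lookup ρ j
M ⊨ ¬ᶠ φ      [ ρ ] = ¬ (M ⊨ φ [ ρ ])
M ⊨ φ ∧ᶠ ψ    [ ρ ] = (M ⊨ φ [ ρ ]) × (M ⊨ ψ [ ρ ])
M ⊨ φ ∨ᶠ ψ    [ ρ ] = (M ⊨ φ [ ρ ]) ⊎ (M ⊨ ψ [ ρ ])
M ⊨ ∃ᶠ φ      [ ρ ] = ∃[ x ] (M ⊨ φ [ x ∷ ρ ])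
M ⊨ ∀ᶠ φ      [ ρ ] = ∀ x → M ⊨ φ [ x ∷ ρ ]

_⊨?_[_] : ∀ {τ n k} (M : Structure τ n) (φ : Formula τ k) (ρ : Vec (Fin n) k) →
          Dec (M ⊨ φ [ ρ ])
M ⊨? atom R is [ ρ ] = T? (⟦ M ⟧ R (Vec.map (Vec.lookup ρ) is))
M ⊨? i ≈ᶠ j    [ ρ ] = Vec.lookup ρ i ≟ Vec.lookup ρ j
M ⊨? ¬ᶠ φ      [ ρ ] = ¬? (M ⊨? φ [ ρ ])
M ⊨? φ ∧ᶠ ψ    [ ρ ] = (M ⊨? φ [ ρ ]) ×-dec (M ⊨? ψ [ ρ ])
M ⊨? φ ∨ᶠ ψ    [ ρ ] = (M ⊨? φ [ ρ ]) ⊎-dec (M ⊨? ψ [ ρ ])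
M ⊨? ∃ᶠ φ      [ ρ ] = any? (λ x → M ⊨? φ [ x ∷ ρ ])
M ⊨? ∀ᶠ φ      [ ρ ] = all? (λ x → M ⊨? φ [ x ∷ ρ ])

------------------------------------------------------------------------
-- Requests and dynamic programs

data Kind : Set where
  insert delete : Kind

record Request (n : ℕ) : Set where
  constructor request
  field
    kind : Kind
    a b  : Fin n
    a≢b  : a ≢ b

-- In the formula for R, indices 0 and 1 are the endpoints a and b of the
-- changed edge and the remaining arity τ R indices are the arguments of R.
Program : Vocabulary → Set
Program τ = Kind → (R : Symbol τ) → Formula τ (2 + arity τ R)

emptyStructure : ∀ {τ n} → Structure τ n
emptyStructure = record { ⟦_⟧ = λ _ _ → false }

update : ∀ {τ n} → Program τ → Request n → Structure τ n → Structure τ n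
update P (request kind a b _) M = record
  { ⟦_⟧ = λ R xs → does (M ⊨? P kind R [ a ∷ b ∷ xs ]) }

-- Histories list the most recent request first.
History : ℕ → Set
History n = List (Request n)

run : ∀ {τ n} → Program τ → History n → Structure τ n
run P = foldr (update P) emptyStructure

------------------------------------------------------------------------
-- Simple undirected graphs whose vertices form a subset of V

record Graph (V : Set) : Set₁ where
  field
    Vertex      : Pred V 0ℓ
    Adj         : Rel V 0ℓ
    symmetric   : Symmetric Adj
    irreflexive : ∀ {x} → ¬ Adj x x
    adj⇒vertex  : ∀ {x y} → Adj x y → Vertex x

open Graph public

module _ {V : Set} where

  vertices : ∀ {R : Rel V 0ℓ} {x y} → Star R x y → List V
  vertices {x = x} ε       = x ∷ []
  vertices {x = x} (_ ◅ w) = x ∷ vertices w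

  edgeCount : ∀ {R : Rel V 0ℓ} {x y} → Star R x y → ℕ
  edgeCount ε       = 0
  edgeCount (_ ◅ w) = suc (edgeCount w)

  -- Membership of the endpoints in Vertex G is not part of the definition:
  -- it matters only for the one-vertex path, and is required wherever
  -- Vertex G is not all of V.
  record GraphPath (G : Graph V) (x y : V) : Set where
    field
      walk   : Star (Adj G) x y
      simple : Unique (vertices walk)

  open GraphPath public

  length : ∀ {G : Graph V} {x y} → GraphPath G x y → ℕ
  length p = edgeCount (walk p)

  _liesOn_ : ∀ {G : Graph V} {x y} → V → GraphPath G x y → Set
  z liesOn p = z ∈ vertices (walk p)

  Connected : Graph V → Rel V 0ℓ
  Connected G x y = GraphPath G x y

  IsShortest : ∀ {G : Graph V} {x y} → GraphPath G x y → Set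
  IsShortest {G} {x} {y} p = (q : GraphPath G x y) → length p ℕ.≤ length q

  IsDistance : Graph V → V → V → ℕ → Set
  IsDistance G x y d = Σ[ p ∈ GraphPath G x y ] (IsShortest p × length p ≡ d)

  _⊑_ : Rel (Graph V) 0ℓ
  H ⊑ G = (Vertex H ⊆ Vertex G) × (Adj H ⇒ Adj G)

  component : Graph V → V → Graph V
  component G v = record
    { Vertex      = Connected G v
    ; Adj         = λ x y → Adj G x y × Connected G v x × Connected G v y
    ; symmetric   = λ (e , cx , cy) → symmetric G e , cy , cx
    ; irreflexive = λ (e , _) → irreflexive G e
    ; adj⇒vertex  = λ (_ , cx , _) → cx
    }

  -- A cycle is a path of length at least 2 together with an edge joining
  -- its endpoints.
  Acyclic : Graph V → Set
  Acyclic G = ∀ {x y} (p : GraphPath G x y) → 2 ℕ.≤ length p → ¬ Adj G y x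

  record IsTree (G : Graph V) : Set where
    field
      connected : ∀ {x y} → Vertex G x → Vertex G y → Connected G x y
      acyclic   : Acyclic G

  record IsSpanningTree (H T : Graph V) : Set where
    field
      subgraph : T ⊑ H
      spanning : Vertex T ≐ Vertex H
      isTree   : IsTree T

  record IsBFSTree (G : Graph V) (v : V) (T : Graph V) : Set where
    field
      spanningTree : IsSpanningTree (component G v) T
      shortest     : ∀ {x} → Vertex T x → (p : GraphPath T v x) (q : GraphPath G v x) →
                     length p ℕ.≤ length q

------------------------------------------------------------------------
-- The input graph and the set U determined by a history

Joins : ∀ {n} → Fin n → Fin n → Rel (Fin n) 0ℓ
Joins a b x y = (x ≡ a × y ≡ b) ⊎ (x ≡ b × y ≡ a)

private
  joins-sym : ∀ {n} {a b : Fin n} → Symmetric (Joins a b)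
  joins-sym (inj₁ (p , q)) = inj₂ (q , p)
  joins-sym (inj₂ (p , q)) = inj₁ (q , p)

  joins-irrefl : ∀ {n} {a b : Fin n} → a ≢ b → ∀ {x} → ¬ Joins a b x x
  joins-irrefl a≢b (inj₁ (p , q)) = a≢b (trans (sym p) q)
  joins-irrefl a≢b (inj₂ (p , q)) = a≢b (trans (sym q) p)

edgeless : ∀ {n} → Graph (Fin n)
edgeless = record
  { Vertex      = λ _ → ⊤
  ; Adj         = λ _ _ → ⊥
  ; symmetric   = λ ()
  ; irreflexive = λ ()
  ; adj⇒vertex  = λ ()
  }

apply : ∀ {n} → Request n → Graph (Fin n) → Graph (Fin n)
apply (request insert a b a≢b) G = record
  { Vertex      = λ _ → ⊤
  ; Adj         = λ x y → Adj G x y ⊎ Joins a b x y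
  ; symmetric   = Sum.map (symmetric G) joins-sym
  ; irreflexive = Sum.[ irreflexive G , joins-irrefl a≢b ]
  ; adj⇒vertex  = λ _ → tt
  }
apply (request delete a b _) G = record
  { Vertex      = λ _ → ⊤
  ; Adj         = λ x y → Adj G x y × ¬ Joins a b x y
  ; symmetric   = λ (e , ne) → symmetric G e , ne ∘ joins-sym
  ; irreflexive = λ (e , _) → irreflexive G e
  ; adj⇒vertex  = λ _ → tt
  }

graph : ∀ {n} → History n → Graph (Fin n)
graph = foldr apply edgeless

OccursInInsertion : ∀ {n} → Fin n → Pred (Request n) 0ℓ
OccursInInsertion x (request insert a b _) = x ≡ a ⊎ x ≡ b
OccursInInsertion x (request delete _ _ _) = ⊥

occursInInsertion? : ∀ {n} (x : Fin n) → U.Decidable (OccursInInsertion x)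
occursInInsertion? x (request insert a b _) = (x ≟ a) ⊎-dec (x ≟ b)
occursInInsertion? x (request delete _ _ _) = no λ ()

Used : ∀ {n} → History n → Pred (Fin n) 0ℓ
Used rs x = Any (OccursInInsertion x) rs

used? : ∀ {n} (rs : History n) → U.Decidable (Used rs)
used? rs x = Any.any? (occursInInsertion? x) rs

------------------------------------------------------------------------
-- Breadth-first search

data BFSSymbol (aux : List ℕ) : Set where
  Edge O Level BFSEdge Path : BFSSymbol aux
  auxiliary                 : Fin (List.length aux) → BFSSymbol aux

bfsVocabulary : List ℕ → Vocabulary
bfsVocabulary aux = record { Symbol = BFSSymbol aux ; arity = ar }
  where
  ar : BFSSymbol aux → ℕ
  ar Edge          = 2
  ar O             = 2
  ar Level         = 3
  ar BFSEdge       = 3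
  ar Path          = 4
  ar (auxiliary i) = List.lookup aux i

module _ {aux : List ℕ} {n : ℕ} (M : Structure (bfsVocabulary aux) n) (rs : History n) where

  private
    G = graph rs
    U = Used rs

  record IsLinearOrderOnUsed : Set where
    field
      onUsed       : ∀ {x y} → Holds M O (x ∷ y ∷ []) → U x × U y
      isTotalOrder : IsTotalOrder {A = ∃ U} (_≡_ on proj₁)
                       ((λ x y → Holds M O (x ∷ y ∷ [])) on proj₁)

  -- O is reflexive on U, so strictly smaller means O-related and distinct.
  rank : Fin n → ℕ
  rank l = List.length (filter below? (allFin n))
    where
    below? : U.Decidable (λ x → U x × Holds M O (x ∷ l ∷ []) × x ≢ l)
    below? x = used? rs x ×-dec T? (⟦ M ⟧ O (x ∷ l ∷ [])) ×-dec ¬? (x ≟ l)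

  record MaintainsBFS : Set₁ where
    field
      edge  : ∀ x y → Holds M Edge (x ∷ y ∷ []) ⇔ Adj G x y
      order : IsLinearOrderOnUsed
      level : ∀ {v x l} → U v → U x → U l →
              Holds M Level (v ∷ x ∷ l ∷ []) ⇔ (Connected G v x × IsDistance G v x (rank l))
      -- In a tree the path p from x to y is unique.
      tree  : ∀ {v} → U v →
              Σ[ Tᵥ ∈ Graph (Fin n) ]
                IsBFSTree G v Tᵥ ×
                (∀ x y → Holds M BFSEdge (v ∷ x ∷ y ∷ []) ⇔ Adj Tᵥ x y) ×
                (∀ {x y z} → Vertex Tᵥ x → Vertex Tᵥ y → Vertex Tᵥ z →
                   Holds M Path (v ∷ x ∷ y ∷ z ∷ []) ⇔ (Σ[ p ∈ GraphPath Tᵥ x y ] z liesOn p))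

  -- The distance of x and y, encoded by the element of U of that rank.
  DefinesDistance : Formula (bfsVocabulary aux) 3 → Set
  DefinesDistance φ = ∀ x y l →
    (M ⊨ φ [ x ∷ y ∷ l ∷ [] ]) ⇔ (U l × IsDistance G x y (rank l))

  DefinesSphere : Formula (bfsVocabulary aux) 3 → Set
  DefinesSphere ψ = ∀ v {l} → U l →
    (λ x → M ⊨ ψ [ x ∷ v ∷ l ∷ [] ]) ≐ (λ x → IsDistance G v x (rank l))

{-# OPTIONS --safe #-}
-- A breadth-first search tree from every vertex is maintained through its ancestor
-- relation, together with the addition of ranks.  A request changes the distances
-- from v only on a set S: for a deleted tree edge a b the vertices below it, for an
-- inserted edge the vertices that come closer to v.  A new shortest path to x ∈ S
-- follows the old tree of v up to its last vertex p ∉ S, takes an edge from p to some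
-- r ∈ S and, since shortest paths between vertices of S survive the request, can
-- continue along the old tree of r.  Choosing for every x ∈ S the pair (p , r) with
-- shortest last part, ties being broken by the linear order, makes these paths a tree
-- again: all vertices on the last part make the same choice.  So one step of choosing
-- replaces the transitive closure that first-order logic cannot express.
module Submission where

open import Defs
open import Data.List.Base using (List)
open import Data.Nat.Base using (ℕ)
open import Data.Product.Base using (Σ-syntax; _×_)
open import Level using (0ℓ)
open import Data.Bool.Base using (T)
open import Data.Bool.Properties using (T?)
open import Data.Empty using (⊥-elim)
open import Data.Fin.Base using (Fin; zero; suc; _↑ʳ_; _↑ˡ_; fromℕ<; toℕ)
open import Data.Fin.Patterns using (0F; 1F; 2F; 3F; 4F; 5F; 6F; 7F; 8F; 9F)
import Data.Fin.Properties as Fin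
open import Data.Fin.Properties using (_≟_; any?)
open import Data.List.Base as List using ([]; _∷_; filter; allFin)
open import Data.List.Membership.Propositional using (_∈_; _∉_)
open import Data.List.Membership.Propositional.Properties using (∈-filter⁺; ∈-filter⁻; ∈-allFin; ∈-lookup)
open import Data.List.Relation.Unary.All as All using ([]; _∷_)
open import Data.List.Relation.Unary.AllPairs using ([]; _∷_)
import Data.List.Relation.Unary.Any as Any
open Any using (here; there)
import Data.List.Relation.Unary.Any.Properties as Any
open import Data.List.Relation.Unary.Unique.Propositional using (Unique)
import Data.List.Relation.Unary.Unique.Propositional.Properties as Unique
open import Data.Nat.Base using (zero; suc; _+_; _∸_; _≤_; _<_; z≤n; s≤s; s≤s⁻¹)
import Data.Nat.Properties as ℕ
open import Data.Product.Base using (∃-syntax; _,_; proj₁; proj₂)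
open import Data.Sum.Base as Sum using (_⊎_; inj₁; inj₂)
open import Data.Unit.Base using (tt)
open import Data.Vec.Base as Vec using (Vec; []; _∷_; tabulate; lookup)
open import Data.Vec.Properties using (map-cong; map-∘)
open import Function.Base using (_∘_)
open import Function.Bundles using (_⇔_; mk⇔; Equivalence)
import Function.Properties.Equivalence as ⇔
open import Relation.Binary.Construct.Closure.ReflexiveTransitive using (Star; ε; _◅_)
open import Relation.Binary.Core using (Rel; _⇒_)
open import Relation.Binary.Definitions using (Symmetric; Decidable; tri<; tri≈; tri>)
open import Relation.Binary.PropositionalEquality using (_≡_; _≢_; refl; sym; trans; cong; cong₂; subst)
open import Relation.Nullary.Decidable using (Dec; yes; no; does; map′; _×-dec_; ¬?)
open import Relation.Nullary.Negation using (¬_; contradiction)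
open import Relation.Unary as U using (Pred)

open Equivalence using (to; from)

-- Walks and distances

-- Both request types share one argument, since `Reroutes` isolates what is needed of `S`: distances
-- and tree paths outside `S` are unchanged, no new edge lies within `S`, and tree paths between
-- vertices of `S` lose no edge. An insertion loses no edge, and the work is to show that a new edge
-- does not have both ends in `S`. A deletion adds no edge, and the work is to show that a tree path
-- between two vertices below the deleted edge does not use it. Distances are numbers, which
-- formulas about vertices can neither name nor add. A shortest path visits distinct used vertices,
-- so every distance is smaller than their number and is the rank of one of them. A sum of ranks may
-- exceed all ranks, but sums are only set equal to ranks or required to lie below them. First-order
-- logic cannot define this addition from the order, so `Plus` is maintained as well; new vertices
-- are appended at the end of the order, so that stored numbers keep their meaning.

data Walk {V : Set} (A : Rel V 0ℓ) : ℕ → Rel V 0ℓ where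
  done : ∀ {x} → Walk A 0 x x
  step : ∀ {k x y z} → A x y → Walk A k y z → Walk A (suc k) x z

record Dist {V : Set} (A : Rel V 0ℓ) (k : ℕ) (x y : V) : Set where
  constructor dist
  field
    walk  : Walk A k x y
    least : ∀ {j} → Walk A j x y → k ≤ j

open Dist public using () renaming (walk to distWalk; least to distLeast)

mapWalk : ∀ {V : Set} {A B : Rel V 0ℓ} → A ⇒ B → ∀ {k} → Walk A k ⇒ Walk B k
mapWalk f done       = done
mapWalk f (step e w) = step (f e) (mapWalk f w)

module _ {V : Set} {A : Rel V 0ℓ} where

  _++ʷ_ : ∀ {i j x y z} → Walk A i x y → Walk A j y z → Walk A (i + j) x z
  done     ++ʷ w = w
  step e v ++ʷ w = step e (v ++ʷ w)

  snocWalk : ∀ {k x y z} → Walk A k x y → A y z → Walk A (suc k) x z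
  snocWalk done       e = step e done
  snocWalk (step f w) e = step f (snocWalk w e)

  walk-zero : ∀ {x y} → Walk A 0 x y → x ≡ y
  walk-zero done = refl

  reverseWalk : Symmetric A → ∀ {k} → Symmetric (Walk A k)
  reverseWalk A-sym done       = done
  reverseWalk A-sym (step e w) = snocWalk (reverseWalk A-sym w) (A-sym e)

  dist-≡ : ∀ {i j x y} → i ≡ j → Dist A i x y → Dist A j x y
  dist-≡ refl d = d

  dist-refl : ∀ {x} → Dist A 0 x x
  dist-refl = dist done (λ _ → z≤n)

  dist-zero : ∀ {x y} → Dist A 0 x y → x ≡ y
  dist-zero d = walk-zero (distWalk d)

  dist-sym : Symmetric A → ∀ {k} → Symmetric (Dist A k)
  dist-sym A-sym (dist w l) = dist (reverseWalk A-sym w) (λ w′ → l (reverseWalk A-sym w′))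

  dist-unique : ∀ {i j x y} → Dist A i x y → Dist A j x y → i ≡ j
  dist-unique (dist w l) (dist w′ l′) = ℕ.≤-antisym (l w′) (l′ w)

  dist-prefix : ∀ {i j x y z} → Walk A i x y → Walk A j y z →
                Dist A (i + j) x z → Dist A i x y
  dist-prefix {i} {j} v w d = dist v
    (λ v′ → ℕ.+-cancelʳ-≤ j i _ (distLeast d (v′ ++ʷ w)))

  dist-suffix : ∀ {i j x y z} → Walk A i x y → Walk A j y z →
                Dist A (i + j) x z → Dist A j y z
  dist-suffix {i} v w d = dist w
    (λ w′ → ℕ.+-cancelˡ-≤ i _ _ (distLeast d (v ++ʷ w′)))

  dist-edge : Symmetric A → ∀ {i j v x y} → A x y → Dist A i v x → Dist A j v y → j ≤ suc i
  dist-edge A-sym e di dj = distLeast dj (snocWalk (distWalk di) e)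

-- The axioms say that the ancestor relation Anc x z ("z lies on the tree path
-- from the root to x") is that of a breadth-first search tree.
record IsAncestry {V : Set} (A : Rel V 0ℓ) (v : V) (Anc : Rel V 0ℓ) : Set where
  field
    below  : ∀ {x z} → Anc x z → ∃[ i ] ∃[ j ] Dist A i v z × Dist A (i + j) v x
    refl-≼ : ∀ {k x} → Dist A k v x → Anc x x
    trans-≼ : ∀ {x y z} → Anc x y → Anc y z → Anc x z
    unique : ∀ {k x y z} → Anc x y → Anc x z → Dist A k v y → Dist A k v z → y ≡ z
    parent : ∀ {k x} → Dist A (suc k) v x → ∃[ y ] Dist A k v y × A y x × Anc x y

  level-≤ : ∀ {i j x z} → Anc x z → Dist A i v z → Dist A j v x → i ≤ j
  level-≤ a di dj with i′ , j′ , di′ , dj′ ← below a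
    rewrite dist-unique di di′ | dist-unique dj dj′ = ℕ.m≤m+n i′ j′

  ancestorAt : ∀ i {j x} → Dist A (j + i) v x → ∃[ z ] Dist A i v z × Anc x z
  ancestorAt i {zero}  d = _ , d , refl-≼ d
  ancestorAt i {suc j} d with y , d′ , e , a ← parent d
                         with z , d″ , a′ ← ancestorAt i {j} d′ = z , d″ , trans-≼ a a′

  -- The path from the root to `y` already contains a vertex on the level of `z`, and `unique`
  -- identifies it with `z`.
  comparable : ∀ {i j x y z} → Anc x y → Anc x z → Dist A j v y → Dist A i v z → i ≤ j → Anc y z
  comparable {i} ay az dj di i≤j
    with m , refl ← ℕ.m≤n⇒∃[o]m+o≡n i≤j
    with z′ , di′ , a ← ancestorAt i {m} (dist-≡ (ℕ.+-comm i m) dj)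
    rewrite unique az (trans-≼ ay a) di di′ = a

  root-≼ : ∀ {k x} → Dist A k v x → Anc x v
  root-≼ {k} d with z , d₀ , a ← ancestorAt 0 {k} (dist-≡ (sym (ℕ.+-identityʳ k)) d)
    rewrite dist-zero d₀ = a

  -- The second relation `B` serves two purposes: with `A` itself the lemma yields distances along
  -- the tree, with `A′` the survival of a tree path. Only edges between ancestors of `x` have to
  -- lie in `B`.
  treeWalk : ∀ {B : Rel V 0ℓ} {i x z} j → Anc x z →
             (∀ {p q} → Anc x p → Anc x q → A q p → B q p) →
             Dist A i v z → Dist A (j + i) v x → Walk B j z x
  treeWalk zero a f di dj rewrite unique a (refl-≼ dj) di dj = done
  treeWalk {i = i} (suc j) a f di dj with y , dy , e , a′ ← parent dj =
    snocWalk (treeWalk j (comparable a′ a dy di (ℕ.m≤n+m i j))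
               (λ p q → f (trans-≼ a′ p) (trans-≼ a′ q)) di dy)
             (f (refl-≼ dj) a′ e)

  dist-≼ : ∀ {i j x z} → Anc x z → Dist A i v z → Dist A (i + j) v x → Dist A j z x
  dist-≼ {i} {j} a di dj = dist-suffix (distWalk di)
    (treeWalk j a (λ _ _ e → e) di (dist-≡ (ℕ.+-comm i j) dj)) dj

  ≼-v : ∀ {z} → Anc v z → v ≡ z
  ≼-v a with i , j , di , dj ← below a
    with refl ← ℕ.m+n≡0⇒m≡0 i (dist-unique dj dist-refl) = dist-zero di

least : ∀ {P : ℕ → Set} → (∀ k → Dec (P k)) → ∀ {k} → P k →
        ∃[ j ] P j × (∀ {i} → P i → j ≤ i)
least {P} P? {k} p with P? 0
... | yes p₀ = 0 , p₀ , λ _ → z≤n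
least {P} P? {zero}  p | no ¬p₀ = contradiction p ¬p₀
least {P} P? {suc k} p | no ¬p₀
  with j , q , l ← least {λ i → P (suc i)} (λ i → P? (suc i)) p =
  suc j , q , λ { {zero} p₀ → contradiction p₀ ¬p₀ ; {suc i} q′ → s≤s (l q′) }

module _ {n : ℕ} {A : Rel (Fin n) 0ℓ} (A? : Decidable A) where

  walk? : ∀ k → Decidable (Walk A k)
  walk? zero    x y = map′ (λ { refl → done }) walk-zero (x ≟ y)
  walk? (suc k) x y = map′ (λ (_ , e , w) → step e w) (λ { (step e w) → _ , e , w })
                        (any? (λ z → A? x z ×-dec walk? k z y))

  shortest : ∀ {k x y} → Walk A k x y → ∃[ j ] Dist A j x y × j ≤ k
  shortest {x = x} {y} w with j , w′ , l ← least (λ k → walk? k x y) w = j , dist w′ l , l w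

  dist? : ∀ k → Decidable (Dist A k)
  dist? k x y with walk? k x y
  ... | no ¬w = no (λ d → ¬w (distWalk d))
  ... | yes w with j , d , _ ← shortest w with j ℕ.≟ k
  ...   | yes refl = yes d
  ...   | no j≢k   = no (λ d′ → j≢k (dist-unique d d′))

-- Rerouting shortest paths

-- Conditions under which the shortest paths from v in A′ are obtained from those
-- in A by changing only the paths to the vertices in S.
record Reroutes {V : Set} (A A′ : Rel V 0ℓ) (v : V) (S : Pred V 0ℓ) (Anc : V → Rel V 0ℓ) : Set where
  field
    root        : ¬ S v
    keep        : ∀ {k x} → ¬ S x → Dist A k v x → Dist A′ k v x
    kept        : ∀ {k x} → ¬ S x → Dist A′ k v x → Dist A k v x
    outside     : ∀ {x z} → ¬ S x → Anc v x z → ¬ S z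
    outsideEdge : ∀ {x y} → ¬ S x → Anc v x y → A y x → A′ y x
    inside      : ∀ {x y} → S x → S y → A′ x y → A x y
    insideEdge  : ∀ {r x y z} → S r → S x → Anc r x y → Anc r x z → A z y → A′ z y

-- In the application `rk` is injective only on used vertices. Being the end of an edge of `A′`
-- replaces being used; the ends of a bridge satisfy it.
module Reroute
  {n : ℕ} {A A′ : Rel (Fin n) 0ℓ} (A? : Decidable A) (A′? : Decidable A′)
  {v : Fin n} {S : Pred (Fin n) 0ℓ} (S? : U.Decidable S) {Anc : Fin n → Rel (Fin n) 0ℓ}
  (ancᵥ : IsAncestry A v (Anc v)) (ancₛ : ∀ {r} → S r → IsAncestry A r (Anc r))
  (rk : Fin n → ℕ) (rk-injective : ∀ {x y z w} → A′ x z → A′ y w → rk x ≡ rk y → x ≡ y)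
  (A′-sym : Symmetric A′)
  (reroutes : Reroutes A A′ v S Anc)
  where

  open Reroutes reroutes
  open IsAncestry

  private V = Fin n

  -- `entry` and `rest` are distances of the old graph, the only ones known when candidates are
  -- collected. Minimality of the total `l` is imposed afterwards.
  record Candidate (x p r : V) (j l : ℕ) : Set where
    constructor candidate
    field
      {i}    : ℕ
      outer  : ¬ S p
      inner  : S r
      bridge : A′ p r
      entry  : Dist A i v p
      rest   : Dist A j r x
      total  : i + suc j ≡ l

  record Exit (k : ℕ) (u x : V) : Set where
    constructor exit
    field
      {i j}  : ℕ
      {p r}  : V
      before : Walk A′ i u p
      outer  : ¬ S p
      bridge : A′ p r
      inner  : S r
      after  : Walk A j r x
      total  : i + suc j ≡ k

  -- Only the part after the last vertex outside `S` is carried back to `A`: there both ends of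
  -- every edge lie in `S`, and `inside` applies.
  lastExit : ∀ {k u x} → S x → Walk A′ k u x → (S u × Walk A k u x) ⊎ Exit k u x
  lastExit Sx done = inj₁ (Sx , done)
  lastExit {u = u} Sx (step e w) with lastExit Sx w
  ... | inj₂ (exit b o br i a t) = inj₂ (exit (step e b) o br i a (cong suc t))
  ... | inj₁ (Sw , w′) with S? u
  ...   | yes Su = inj₁ (Su , step (inside Su Sw e) w′)
  ...   | no ¬Su = inj₂ (exit done ¬Su e Sw w′ refl)

  -- The tree of `r` contains a shortest path to `x`, all of whose edges survive by `insideEdge`.
  -- This alone does not keep the path inside `S`.
  insideWalk : ∀ {k r x} → S r → S x → Dist A k r x → Walk A′ k r x
  insideWalk {k} Sr Sx d = treeWalk (ancₛ Sr) k (root-≼ (ancₛ Sr) d) (insideEdge Sr Sx)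
    dist-refl (dist-≡ (sym (ℕ.+-identityʳ k)) d)

  candidate-walk : ∀ {x p r j l} → S x → Candidate x p r j l → Walk A′ l v x
  candidate-walk Sx (candidate ¬Sp Sr e di dj refl) =
    distWalk (keep ¬Sp di) ++ʷ step e (insideWalk Sr Sx dj)

  -- A shorter way from `r` to `x` in `A` would, through `insideWalk`, shorten the path in `A′`; so
  -- the part after the exit is a shortest one. The walk `w` in front allows an exit in the middle
  -- of a path, as needed in `split`.
  exit-candidate : ∀ {x y k m} → S x → Walk A′ k v y → (ex : Exit m y x) → Dist A′ (k + m) v x →
                   Candidate x (Exit.p ex) (Exit.r ex) (Exit.j ex) (k + m)
  exit-candidate {x} {k = k} Sx w (exit {i} {j} {p} {r} b ¬Sp e Sr a refl) d =
    candidate ¬Sp Sr e (kept ¬Sp (dist-prefix {j = suc j} w′ (step e aft) d′)) (dist a a-least)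
      (ℕ.+-assoc k i (suc j))
    where
    w′ = w ++ʷ b
    d′ : Dist A′ ((k + i) + suc j) v x
    d′ = dist-≡ (sym (ℕ.+-assoc k i (suc j))) d
    a-least : ∀ {m} → Walk A m r x → j ≤ m
    a-least a′ with m , dm , m≤ ← shortest A? a′ =
      ℕ.≤-trans (s≤s⁻¹ (ℕ.+-cancelˡ-≤ (k + i) _ _
        (distLeast d′ (w′ ++ʷ step e (insideWalk Sr Sx dm))))) m≤
    aft : Walk A′ j r x
    aft = insideWalk Sr Sx (dist a a-least)

  candidate-exists : ∀ {x l} → S x → Dist A′ l v x → ∃[ p ] ∃[ r ] ∃[ j ] Candidate x p r j l
  candidate-exists Sx d with lastExit Sx (distWalk d)
  ... | inj₁ (Sv , _) = contradiction Sv root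
  ... | inj₂ ex       = _ , _ , _ , exit-candidate Sx done ex d

  -- Every candidate gives a walk and a shortest path gives a candidate, so the least total is the
  -- distance. The formula of `measure` rests on this.
  candidate-dist : ∀ {x p r j l} → S x → Candidate x p r j l →
                   (∀ {p r j m} → Candidate x p r j m → l ≤ m) → Dist A′ l v x
  candidate-dist Sx c l-least with m , d , m≤l ← shortest A′? (candidate-walk Sx c)
    with _ , _ , _ , c′ ← candidate-exists Sx d
    rewrite ℕ.≤-antisym (l-least c′) m≤l = d

  -- The total determines `i` as `l ∸ suc j`, so it need not be searched for; the last test rejects
  -- a truncated subtraction.
  candidate? : ∀ x p r j l → Dec (Candidate x p r j l)
  candidate? x p r j l = map′
    (λ (o , i , b , e , rs , t) → candidate o i b e rs t)
    (λ (candidate {i} o r∈S b e rs t) → let eq = trans (sym (ℕ.m+n∸n≡m i (suc j))) (cong (_∸ suc j) t) in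
       o , r∈S , b , dist-≡ eq e , rs , trans (cong (_+ suc j) (sym eq)) t)
    (¬? (S? p) ×-dec S? r ×-dec A′? p r ×-dec dist? A? (l ∸ suc j) v p ×-dec
     dist? A? j r x ×-dec ((l ∸ suc j) + suc j ℕ.≟ l))

  Precedes : (j : ℕ) (p r : V) (j′ : ℕ) (p′ r′ : V) → Set
  Precedes j p r j′ p′ r′ = j < j′ ⊎ j ≡ j′ × (rk p < rk p′ ⊎ rk p ≡ rk p′ × rk r < rk r′)

  incomparable : ∀ {j p r j′ p′ r′} → ¬ Precedes j p r j′ p′ r′ → ¬ Precedes j′ p′ r′ j p r →
                 j ≡ j′ × rk p ≡ rk p′ × rk r ≡ rk r′
  incomparable {j} {p} {r} {j′} {p′} {r′} ¬lt ¬gt with ℕ.<-cmp j j′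
  ... | tri< lt _ _ = contradiction (inj₁ lt) ¬lt
  ... | tri> _ _ gt = contradiction (inj₁ gt) ¬gt
  ... | tri≈ _ j≡ _ with ℕ.<-cmp (rk p) (rk p′)
  ...   | tri< lt _ _ = contradiction (inj₂ (j≡ , inj₁ lt)) ¬lt
  ...   | tri> _ _ gt = contradiction (inj₂ (sym j≡ , inj₁ gt)) ¬gt
  ...   | tri≈ _ p≡ _ with ℕ.<-cmp (rk r) (rk r′)
  ...     | tri< lt _ _ = contradiction (inj₂ (j≡ , inj₂ (p≡ , lt))) ¬lt
  ...     | tri> _ _ gt = contradiction (inj₂ (sym j≡ , inj₂ (sym p≡ , gt))) ¬gt
  ...     | tri≈ _ r≡ _ = j≡ , p≡ , r≡

  -- Minimality of j keeps the last part of the path inside S.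
  record Best (x p r : V) : Set where
    constructor best
    field
      {j l}   : ℕ
      level   : Dist A′ l v x
      cand    : Candidate x p r j l
      minimal : ∀ {p′ r′ j′} → Candidate x p′ r′ j′ l → ¬ Precedes j′ p′ r′ j p r

  best-unique : ∀ {x p r p′ r′} → Best x p r → Best x p′ r′ → p ≡ p′ × r ≡ r′
  best-unique (best d c m) (best d′ c′ m′) with refl ← dist-unique d d′
    with _ , p≡ , r≡ ← incomparable (m′ c) (m c′) =
    rk-injective (bridge c) (bridge c′) p≡ ,
    rk-injective (A′-sym (bridge c)) (A′-sym (bridge c′)) r≡
    where open Candidate

  -- Three searches minimise the entries of `Precedes` in turn. They minimise the rank of `p`, not
  -- `p` itself, so the last case recovers `p` by injectivity.
  best-exists : ∀ {x l} → S x → Dist A′ l v x → ∃[ p ] ∃[ r ] Best x p r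
  best-exists {x} {l} Sx d
    with _ , _ , _ , c₀ ← candidate-exists Sx d
    with j , (_ , _ , c₁) , j-least ← least (λ j → any? λ p → any? λ r → candidate? x p r j l) (_ , _ , c₀)
    with _ , (p , refl , _ , c₂) , p-least ←
      least (λ q → any? λ p → rk p ℕ.≟ q ×-dec any? λ r → candidate? x p r j l) (_ , refl , _ , c₁)
    with _ , (r , refl , c) , r-least ←
      least (λ q → any? λ r → rk r ℕ.≟ q ×-dec candidate? x p r j l) (_ , refl , c₂) =
    p , r , best d c λ where
      c′ (inj₁ lt) → ℕ.<⇒≱ lt (j-least (_ , _ , c′))
      c′ (inj₂ (refl , inj₁ lt)) → ℕ.<⇒≱ lt (p-least (_ , refl , _ , c′))
      c′ (inj₂ (refl , inj₂ (p≡ , lt))) →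
        ℕ.<⇒≱ lt (r-least (_ , refl ,
          subst (λ p → Candidate x p _ j l) (rk-injective (Candidate.bridge c′) (Candidate.bridge c) p≡) c′))

  record BestSplit (x p r y : V) : Set where
    field
      {i j₁ j₂} : ℕ
      entry     : Dist A′ i v p
      upper     : Dist A j₁ r y
      level     : Dist A′ (i + suc j₁) v y
      levelˣ    : Dist A′ ((i + suc j₁) + j₂) v x
      inner     : S y
      best-y    : Best y p r

  -- Candidates of y extend along the path from y to candidates of x, with the same p and r
  -- and all last parts lengthened equally, so the choice for x is also the choice for y.
  split : ∀ {x p r y} → S x → Best x p r → Anc r x y → BestSplit x p r y
  split {x} {p} {r} {y} Sx (best {j} {l} d (candidate {i} ¬Sp Sr e di dj refl) minimal) a
    with j₁ , j₂ , dj₁ , dj′ ← below (ancₛ Sr) a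
    with refl ← dist-unique dj dj′ = record
      { entry = keep ¬Sp di ; upper = dj₁ ; level = level ; levelˣ = dˣ
      ; inner = inner ; best-y = best level (candidate ¬Sp Sr e di dj₁ refl) minimal-y }
    where
    tree = ancₛ Sr
    edges : ∀ {p q} → Anc r x p → Anc r x q → A q p → A′ q p
    edges = insideEdge Sr Sx
    lower : Walk A′ j₂ y x
    lower = treeWalk tree j₂ a edges dj₁ (dist-≡ (ℕ.+-comm j₁ j₂) dj)
    lowerᴬ : Walk A j₂ y x
    lowerᴬ = distWalk (dist-≼ tree a dj₁ dj)
    upper : Walk A′ j₁ r y
    upper = treeWalk tree j₁ (root-≼ tree dj₁) (λ b c → edges (trans-≼ tree a b) (trans-≼ tree a c))
              dist-refl (dist-≡ (sym (ℕ.+-identityʳ j₁)) dj₁)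
    wy : Walk A′ (i + suc j₁) v y
    wy = distWalk (keep ¬Sp di) ++ʷ step e upper
    l≡ : i + suc (j₁ + j₂) ≡ (i + suc j₁) + j₂
    l≡ = sym (ℕ.+-assoc i (suc j₁) j₂)
    dˣ : Dist A′ ((i + suc j₁) + j₂) v x
    dˣ = dist-≡ l≡ d
    level : Dist A′ (i + suc j₁) v y
    level = dist-prefix wy lower dˣ
    inner : S y
    inner with S? y
    ... | yes Sy = Sy
    -- If `y` were outside `S`, the last exit would occur at or below `y` and give a candidate whose
    -- last part is shorter than `j₁ + j₂`.
    ... | no ¬Sy with lastExit Sx lower
    ...   | inj₁ (Sy , _) = contradiction Sy ¬Sy
    ...   | inj₂ ex@(exit {i′} {j′} b o br s a′ t) = ⊥-elim (minimal
              (subst (Candidate x _ _ _) (sym l≡) (exit-candidate Sx wy ex dˣ))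
              (inj₁ (ℕ.≤-trans (ℕ.≤-trans (ℕ.m≤n+m (suc j′) i′) (ℕ.≤-reflexive t)) (ℕ.m≤n+m j₂ j₁))))
    minimal-y : ∀ {p′ r′ j′} → Candidate y p′ r′ j′ (i + suc j₁) → ¬ Precedes j′ p′ r′ j₁ p r
    minimal-y {p′} {r′} {j′} (candidate {i′} ¬Sp′ Sr′ e′ di′ dj₁′ t) lt =
      minimal (candidate ¬Sp′ Sr′ e′ di′ (dist wx wx-least) t′) (shift lt)
      where
      wx : Walk A (j′ + j₂) r′ x
      wx = distWalk dj₁′ ++ʷ lowerᴬ
      t′ : i′ + suc (j′ + j₂) ≡ i + suc (j₁ + j₂)
      t′ = trans (sym (ℕ.+-assoc i′ (suc j′) j₂)) (trans (cong (_+ j₂) t) (sym l≡))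
      -- By `t′` the prolonged candidate has the optimal total, so its last part cannot be
      -- shortened.
      wx-least : ∀ {m} → Walk A m r′ x → j′ + j₂ ≤ m
      wx-least w with m , dm , m≤ ← shortest A? w =
        ℕ.≤-trans (s≤s⁻¹ (ℕ.+-cancelˡ-≤ i′ _ _ (ℕ.≤-trans (ℕ.≤-reflexive t′)
          (distLeast d (candidate-walk Sx (candidate ¬Sp′ Sr′ e′ di′ dm refl)))))) m≤
      shift : Precedes j′ p′ r′ j₁ p r → Precedes (j′ + j₂) p′ r′ (j₁ + j₂) p r
      shift (inj₁ lt)         = inj₁ (ℕ.+-monoˡ-< j₂ lt)
      shift (inj₂ (refl , c)) = inj₂ (refl , c)

  -- No case refers to `Anc′` itself, only to the old ancestor relations of `v` and `r`; hence a
  -- single first-order formula defines it.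
  data Anc′ (x z : V) : Set where
    old   : ¬ S x → Anc v x z → Anc′ x z
    upper : ∀ {p r} → S x → Best x p r → Anc v p z → Anc′ x z
    lower : ∀ {p r} → S x → Best x p r → Anc r x z → Anc′ x z

  private
    inner′ : ∀ {x p r} → Best x p r → S r
    inner′ b = Candidate.inner (Best.cand b)
    outer′ : ∀ {x p r} → Best x p r → ¬ S p
    outer′ b = Candidate.outer (Best.cand b)

  ancestry′ : IsAncestry A′ v Anc′
  ancestry′ = record { below = below′ ; refl-≼ = refl′ ; trans-≼ = trans′ ; unique = unique′ ; parent = parent′ }
    where
    below′ : ∀ {x z} → Anc′ x z → ∃[ i ] ∃[ j ] Dist A′ i v z × Dist A′ (i + j) v x
    below′ (old ¬Sx a) with i , j , di , dj ← below ancᵥ a = i , j , keep (outside ¬Sx a) di , keep ¬Sx dj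
    below′ (upper Sx (best d (candidate ¬Sp _ _ di _ refl) _) a)
      with i , j , di′ , dj′ ← below ancᵥ a with refl ← dist-unique di dj′ =
      i , _ , keep (outside ¬Sp a) di′ , dist-≡ (ℕ.+-assoc i j _) d
    below′ (lower Sx b a) = _ , _ , BestSplit.level s , BestSplit.levelˣ s
      where s = split Sx b a

    refl′ : ∀ {k x} → Dist A′ k v x → Anc′ x x
    refl′ {x = x} d with S? x
    ... | no ¬Sx = old ¬Sx (refl-≼ ancᵥ (kept ¬Sx d))
    ... | yes Sx with _ , _ , b ← best-exists Sx d =
      lower Sx b (refl-≼ (ancₛ (inner′ b)) (Candidate.rest (Best.cand b)))

    trans′ : ∀ {x y z} → Anc′ x y → Anc′ y z → Anc′ x z
    trans′ (old ¬Sx a) (old _ b) = old ¬Sx (trans-≼ ancᵥ a b)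
    trans′ (old ¬Sx a) (upper Sy _ _) = contradiction Sy (outside ¬Sx a)
    trans′ (old ¬Sx a) (lower Sy _ _) = contradiction Sy (outside ¬Sx a)
    trans′ (upper Sx b a) (old _ a′) = upper Sx b (trans-≼ ancᵥ a a′)
    trans′ (upper Sx b a) (upper Sy _ _) = contradiction Sy (outside (outer′ b) a)
    trans′ (upper Sx b a) (lower Sy _ _) = contradiction Sy (outside (outer′ b) a)
    trans′ (lower Sx b a) (old ¬Sy _) = contradiction (BestSplit.inner (split Sx b a)) ¬Sy
    trans′ (lower Sx b a) (upper Sy b′ a′)
      with refl , refl ← best-unique (BestSplit.best-y (split Sx b a)) b′ = upper Sx b a′
    trans′ (lower Sx b a) (lower Sy b′ a′)
      with refl , refl ← best-unique (BestSplit.best-y (split Sx b a)) b′ =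
      lower Sx b (trans-≼ (ancₛ (inner′ b)) a a′)

    -- Vertices of the upper part lie on levels up to that of `p`, those of the lower part on
    -- strictly larger ones.
    crossed : ∀ {k x y z p r} → S x → Best x p r → Anc v p y → Anc r x z →
              Dist A′ k v y → ¬ Dist A′ k v z
    crossed {k} Sx b ay az dy dz with refl ← dist-unique (BestSplit.level (split Sx b az)) dz =
      ℕ.<⇒≱ (ℕ.m<m+n (BestSplit.i s) (s≤s z≤n))
        (level-≤ ancᵥ ay (kept (outside (outer′ b) ay) dy) (kept (outer′ b) (BestSplit.entry s)))
      where s = split Sx b az

    unique′ : ∀ {k x y z} → Anc′ x y → Anc′ x z → Dist A′ k v y → Dist A′ k v z → y ≡ z
    unique′ (old ¬Sx a) (old _ a′) dy dz = unique ancᵥ a a′ (kept (outside ¬Sx a) dy) (kept (outside ¬Sx a′) dz)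
    unique′ (old ¬Sx _) (upper Sx _ _) _ _ = contradiction Sx ¬Sx
    unique′ (old ¬Sx _) (lower Sx _ _) _ _ = contradiction Sx ¬Sx
    unique′ (upper Sx _ _) (old ¬Sx _) _ _ = contradiction Sx ¬Sx
    unique′ (lower Sx _ _) (old ¬Sx _) _ _ = contradiction Sx ¬Sx
    unique′ (upper Sx b a) (upper _ b′ a′) dy dz with refl , refl ← best-unique b b′ =
      unique ancᵥ a a′ (kept (outside (outer′ b) a) dy) (kept (outside (outer′ b) a′) dz)
    unique′ (upper Sx b a) (lower _ b′ a′) dy dz with refl , refl ← best-unique b b′ =
      contradiction dz (crossed Sx b a a′ dy)
    unique′ (lower Sx b a) (upper _ b′ a′) dy dz with refl , refl ← best-unique b b′ =
      contradiction dy (crossed Sx b a′ a dz)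
    unique′ (lower Sx b a) (lower _ b′ a′) dy dz with refl , refl ← best-unique b b′ =
      unique (ancₛ (inner′ b)) a a′ (BestSplit.upper s)
        (dist-≡ (ℕ.suc-injective (ℕ.+-cancelˡ-≡ (BestSplit.i s) _ _ eq)) (BestSplit.upper s′))
      where
      s = split Sx b a
      s′ = split Sx b a′
      eq : BestSplit.i s + suc (BestSplit.j₁ s′) ≡ BestSplit.i s + suc (BestSplit.j₁ s)
      eq = trans (cong (_+ suc (BestSplit.j₁ s′)) (dist-unique (BestSplit.entry s) (BestSplit.entry s′)))
             (trans (dist-unique (BestSplit.level s′) dz) (dist-unique dy (BestSplit.level s)))

    -- For `j = 0` the vertex `x` is `r`, and its parent lies across the bridge; otherwise the
    -- parent is the one in the tree of `r`.
    bestParent : ∀ {j k x p r} → S x → Best x p r → Candidate x p r j (suc k) →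
                 ∃[ y ] Dist A′ k v y × A′ y x × Anc′ x y
    bestParent {zero} {k} Sx b (candidate {i} ¬Sp Sr e di dj t) with refl ← dist-zero dj =
      _ , dist-≡ (ℕ.suc-injective (trans (ℕ.+-comm 1 i) t)) (keep ¬Sp di) , e , upper Sx b (refl-≼ ancᵥ di)
    bestParent {suc j} {k} Sx b (candidate {i} ¬Sp Sr e di dj t) with y , dy , e′ , a ← parent (ancₛ Sr) dj =
      y , dist-≡ eq (BestSplit.level s) , insideEdge Sr Sx (refl-≼ (ancₛ Sr) dj) a e′ , lower Sx b a
      where
      s = split Sx b a
      eq : BestSplit.i s + suc (BestSplit.j₁ s) ≡ k
      eq rewrite dist-unique (BestSplit.entry s) (keep ¬Sp di) | dist-unique (BestSplit.upper s) dy =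
        ℕ.suc-injective (trans (sym (ℕ.+-suc i (suc j))) t)

    parent′ : ∀ {k x} → Dist A′ (suc k) v x → ∃[ y ] Dist A′ k v y × A′ y x × Anc′ x y
    parent′ {x = x} d with S? x
    ... | no ¬Sx with y , dy , e , a ← parent ancᵥ (kept ¬Sx d) =
      y , keep (outside ¬Sx a) dy , outsideEdge ¬Sx a e , old ¬Sx a
    ... | yes Sx with _ , _ , b ← best-exists Sx d =
      bestParent Sx b (subst (Candidate x _ _ _) (dist-unique (Best.level b) d) (Best.cand b))

-- The tree of an ancestor relation

module _ {V : Set} where

  head-∈ : ∀ {R : Rel V 0ℓ} {x y} (w : Star R x y) → x ∈ vertices w
  head-∈ ε       = here refl
  head-∈ (_ ◅ _) = here refl

  last-∈ : ∀ {R : Rel V 0ℓ} {x y} (w : Star R x y) → y ∈ vertices w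
  last-∈ ε       = here refl
  last-∈ (_ ◅ w) = there (last-∈ w)

  ∉-∷ : ∀ {x : V} {xs} → x ∉ xs → Unique xs → Unique (x ∷ xs)
  ∉-∷ x∉ u = All.tabulate (λ z∈ x≡z → x∉ (subst (_∈ _) (sym x≡z) z∈)) ∷ u

  ∷-∉ : ∀ {x : V} {xs} → Unique (x ∷ xs) → x ∉ xs
  ∷-∉ (x≢ ∷ _) x∈ = All.lookup x≢ x∈ refl

  starWalk : ∀ {R : Rel V 0ℓ} {x y} (w : Star R x y) → Walk R (edgeCount w) x y
  starWalk ε       = done
  starWalk (e ◅ w) = step e (starWalk w)

  suffix : ∀ {R : Rel V 0ℓ} {x y z} (w : Star R x y) → z ∈ vertices w →
           ∃[ j ] Walk R j z y × j ≤ edgeCount w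
  suffix ε       (here refl) = 0 , done , z≤n
  suffix (e ◅ w) (here refl) = _ , step e (starWalk w) , ℕ.≤-refl
  suffix (e ◅ w) (there z∈) with j , v , j≤ ← suffix w z∈ = j , v , ℕ.m≤n⇒m≤1+n j≤

  module _ {G : Graph V} where

    -- If the first vertex occurred again, the walk from that occurrence on would be shorter.
    dist⇒path : ∀ {k x y} → Dist (Adj G) k x y → Σ[ p ∈ GraphPath G x y ] length p ≡ k
    dist⇒path d = go (distWalk d) (distLeast d)
      where
      go : ∀ {k x y} → Walk (Adj G) k x y → (∀ {j} → Walk (Adj G) j x y → k ≤ j) →
           Σ[ p ∈ GraphPath G x y ] length p ≡ k
      go done _ = record { walk = ε ; simple = [] ∷ [] } , refl
      go (step e w) l with p , refl ← go w (λ w′ → s≤s⁻¹ (l (step e w′))) =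
        record { walk = e ◅ walk p
               ; simple = ∉-∷ (λ x∈ → let _ , w′ , j≤ = suffix (walk p) x∈ in
                                      ℕ.<⇒≱ (s≤s j≤) (l w′)) (simple p) } , refl

    module _ (shorten : ∀ {k x y} → Walk (Adj G) k x y → ∃[ j ] Dist (Adj G) j x y × j ≤ k) where

      dist⇒isDistance : ∀ {k x y} → Dist (Adj G) k x y → IsDistance G x y k
      dist⇒isDistance d with p , refl ← dist⇒path d = p , (λ q → distLeast d (starWalk (walk q))) , refl

      -- `IsShortest` compares with simple paths only; an arbitrary walk is first replaced by a
      -- shortest one, which is simple.
      isDistance⇒dist : ∀ {k x y} → IsDistance G x y k → Dist (Adj G) k x y
      isDistance⇒dist (p , s , refl) = dist (starWalk (walk p)) λ w →
        let j , d , j≤ = shorten w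
            q , q≡ = dist⇒path d
        in ℕ.≤-trans (s q) (ℕ.≤-trans (ℕ.≤-reflexive q≡) j≤)

      dist⇒connected : ∀ {k x y} → Dist (Adj G) k x y → Connected G x y
      dist⇒connected d = proj₁ (dist⇒path d)

module BFSTree {n : ℕ} (G : Graph (Fin n)) (Adj? : Decidable (Adj G)) (v : Fin n)
  {Anc : Rel (Fin n) 0ℓ} (Anc? : Decidable Anc) (ancestry : IsAncestry (Adj G) v Anc) where

  open IsAncestry ancestry
  private V = Fin n

  Parent : Rel V 0ℓ
  Parent x y = Anc x y × Adj G x y

  TreeEdge : Rel V 0ℓ
  TreeEdge x y = Parent x y ⊎ Parent y x

  -- The second condition places z below the lowest common ancestor of x and y.
  OnPath : V → V → V → Set
  OnPath x y z = (Anc x z ⊎ Anc y z) × (∀ w → Anc x w → Anc y w → Anc z w)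

  InTree : Pred V 0ℓ
  InTree x = ∃[ k ] Dist (Adj G) k v x

  inTree-lower : ∀ {x y} → Anc x y → InTree x
  inTree-lower a with _ , _ , _ , d ← below a = _ , d

  inTree-upper : ∀ {x y} → Anc x y → InTree y
  inTree-upper a with _ , _ , d , _ ← below a = _ , d

  reflT : ∀ {x} → InTree x → Anc x x
  reflT (_ , d) = refl-≼ d

  -- An edge changes the level by at most one, and the only ancestor of `x` on its own level is `x`.
  -- So an adjacent ancestor is exactly one level higher up.
  parent-level : ∀ {x y k} → Parent x y → Dist (Adj G) k v y → Dist (Adj G) (suc k) v x
  parent-level {x} {y} (a , e) dy with i , j , dy′ , dx ← below a with refl ← dist-unique dy dy′ = go j dx
    where
    go : ∀ j → Dist (Adj G) (i + j) v x → Dist (Adj G) (suc i) v x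
    go 0 d with refl ← unique (refl-≼ d) a (dist-≡ (ℕ.+-identityʳ i) d) dy = contradiction e (irreflexive G)
    go 1 d = dist-≡ (ℕ.+-comm i 1) d
    go (suc (suc j)) d = contradiction (dist-edge (symmetric G) (symmetric G e) dy d)
      (ℕ.<⇒≱ (subst (suc i <_) (sym (ℕ.+-suc i (suc j))) (s≤s (ℕ.m<m+n i (s≤s z≤n)))))

  parent-unique : ∀ {x y z} → Parent x y → Parent x z → y ≡ z
  parent-unique p@(a , _) q@(b , _) with _ , dy ← inTree-upper a with _ , dz ← inTree-upper b
    with refl ← ℕ.suc-injective (dist-unique (parent-level p dy) (parent-level q dz)) = unique a b dy dz

  parent-not-below : ∀ {x y} → Parent x y → ¬ Anc y x
  parent-not-below p@(a , _) b with _ , dy ← inTree-upper a = ℕ.<⇒≱ ℕ.≤-refl (level-≤ b (parent-level p dy) dy)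

  anc-parent : ∀ {x y z} → Parent x y → Anc x z → z ≢ x → Anc y z
  anc-parent {x} {y} {z} p@(a , _) b z≢x with k , dy ← inTree-upper a with i , dz ← inTree-upper b =
    comparable a b dy dz (s≤s⁻¹ (ℕ.≤∧≢⇒< (level-≤ b dz dx) λ { refl → z≢x (unique b (refl-≼ dx) dz dx) }))
    where dx = parent-level p dy

  parentOf : ∀ {x k} → Dist (Adj G) (suc k) v x → ∃[ y ] Dist (Adj G) k v y × Parent x y
  parentOf d with y , dy , e , a ← parent d = y , dy , a , symmetric G e

  Descends : ∀ {x y} (c : V) → Star TreeEdge x y → Set
  Descends {x} {y} c w = (∀ {z} → z ∈ vertices w → Anc z c × Anc y z) ×
                         (∀ {k} → Dist (Adj G) k v x → Dist (Adj G) (k + edgeCount w) v y)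

  -- A step up would return to the unique parent, from which the walk has just come. So a simple
  -- walk that starts downwards descends throughout, and levels count its edges.
  descend : ∀ {x c y} → Parent c x → (w : Star TreeEdge c y) → Unique (x ∷ vertices w) → Descends c w
  descend p@(a , _) ε u = (λ { (here refl) → reflT (inTree-lower a) , reflT (inTree-lower a) }) ,
    dist-≡ (sym (ℕ.+-identityʳ _))
  descend p (inj₁ q ◅ w) u with refl ← parent-unique p q = contradiction (there (head-∈ w)) (∷-∉ u)
  descend {c = c} {y} p@(a , _) (inj₂ q ◅ w) (_ ∷ u) with between , level ← descend q w u = between′ , λ {k} d →
      dist-≡ (sym (ℕ.+-suc k _)) (level (parent-level q d))
    where
    between′ : ∀ {z} → z ∈ c ∷ vertices w → Anc z c × Anc y z
    between′ (here refl) = reflT (inTree-lower a) , trans-≼ (proj₂ (between (head-∈ w))) (proj₁ q)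
    between′ (there z∈)  = trans-≼ (proj₁ (between z∈)) (proj₁ q) , proj₂ (between z∈)

  -- The subtree of `x` can be entered only through `x`.
  avoid : ∀ {u x y} (w : Star TreeEdge u y) → ¬ Anc u x → x ∉ vertices w → ¬ Anc y x
  avoid ε ¬a _ = ¬a
  avoid (inj₁ p ◅ w) ¬a x∉ = avoid w (λ a → ¬a (trans-≼ (proj₁ p) a)) (λ x∈ → x∉ (there x∈))
  avoid (inj₂ p ◅ w) ¬a x∉ = avoid w (λ a → ¬a (anc-parent p a λ { refl → x∉ (there (head-∈ w)) }))
    (λ x∈ → x∉ (there x∈))

  leave : ∀ {x p y} → Parent x p → (w : Star TreeEdge p y) → Unique (x ∷ vertices w) → ¬ Anc y x
  leave q w u = avoid w (parent-not-below q) (∷-∉ u)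

  -- After a step up from `x`, `leave` shows that `x` is no ancestor of `y`. Hence every common
  -- ancestor of `x` and `y` is also an ancestor of the parent, and the claim for the shorter walk
  -- applies.
  path-sound : ∀ {x y z} (w : Star TreeEdge x y) → Unique (vertices w) → InTree x →
               z ∈ vertices w → OnPath x y z
  path-sound ε u t (here refl) = inj₁ (reflT t) , λ _ a _ → a
  path-sound (e ◅ w) u t (here refl) = inj₁ (reflT t) , λ _ a _ → a
  path-sound (inj₂ p ◅ w) u t (there z∈) with between , _ ← descend p w u with a , b ← between z∈ =
    inj₂ b , λ _ c _ → trans-≼ a (trans-≼ (proj₁ p) c)
  path-sound (inj₁ p ◅ w) u@(_ ∷ u′) t (there z∈)
    with side , top ← path-sound w u′ (inTree-upper (proj₁ p)) z∈ =
    Sum.map₁ (trans-≼ (proj₁ p)) side ,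
    λ q a b → top q (anc-parent p a (λ { refl → leave p w u b })) b

  tree : Graph V
  tree = record
    { Vertex      = Connected G v
    ; Adj         = TreeEdge
    ; symmetric   = λ { (inj₁ p) → inj₂ p ; (inj₂ p) → inj₁ p }
    ; irreflexive = λ { (inj₁ (_ , e)) → irreflexive G e ; (inj₂ (_ , e)) → irreflexive G e }
    ; adj⇒vertex  = λ { (inj₁ (a , _)) → inTree⇒connected (inTree-lower a)
                      ; (inj₂ (a , _)) → inTree⇒connected (inTree-upper a) }
    }
    where
    inTree⇒connected : ∀ {x} → InTree x → Connected G v x
    inTree⇒connected (_ , d) = proj₁ (dist⇒path d)

  connected⇒inTree : ∀ {x} → Connected G v x → InTree x
  connected⇒inTree p with k , d , _ ← shortest Adj? (starWalk (walk p)) = k , d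

  private
    cons : ∀ {x y z} → TreeEdge x y → (p : GraphPath tree y z) → x ∉ vertices (walk p) → GraphPath tree x z
    cons e p x∉ = record { walk = e ◅ walk p ; simple = ∉-∷ x∉ (simple p) }

  childParent : ∀ {i c x y} → Anc y x → Anc y c → Dist (Adj G) i v x → Dist (Adj G) (suc i) v c → Parent c x
  childParent a b dx dc with q , dq , p@(ca , _) ← parentOf dc
    with refl ← unique (trans-≼ b ca) a dq dx = p

  -- The path is built from its upper end: its next vertex is the ancestor of `y` one level further
  -- from the root.
  pathDown : ∀ j {i x y} → Dist (Adj G) i v x → Dist (Adj G) (j + i) v y → Anc y x →
             Σ[ p ∈ GraphPath tree x y ] (∀ {z} → z liesOn p → Anc z x) ×
                                         (∀ {z} → Anc y z → Anc z x → z liesOn p)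
  pathDown zero {i} dx dy a with refl ← unique a (refl-≼ dy) dx dy =
    record { walk = ε ; simple = [] ∷ [] } , (λ { (here refl) → a }) , λ {z} b c →
    let m , dz = inTree-upper b in
    here (unique {i} b a (dist-≡ (ℕ.≤-antisym (level-≤ b dz dx) (level-≤ c dx dz)) dz) dx)
  pathDown (suc j) {i} {x} {y} dx dy a
    with c , dc , b ← ancestorAt (suc i) {j} (dist-≡ (sym (ℕ.+-suc j i)) dy)
    with p@(pa , _) ← childParent a b dx dc
    with path , under , complete ← pathDown j dc (dist-≡ (sym (ℕ.+-suc j i)) dy) b =
    cons (inj₂ p) path (λ x∈ → parent-not-below p (under x∈)) ,
    (λ { (here refl) → refl-≼ dx ; (there z∈) → trans-≼ (under z∈) pa }) ,
    λ {z} yz zx → complete′ yz zx (z ≟ x)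
    where
    complete′ : ∀ {z} → Anc y z → Anc z x → Dec (z ≡ x) → z ∈ x ∷ vertices (walk path)
    complete′ yz zx (yes refl) = here refl
    complete′ yz zx (no z≢x) with m , dz ← inTree-upper yz =
      there (complete yz (comparable yz b dz dc
        (ℕ.≤∧≢⇒< (level-≤ zx dx dz) λ { refl → z≢x (unique yz a dz dx) })))

  -- The path climbs from `x` until it meets an ancestor of `y`, at the latest the root, and then
  -- descends.
  path : ∀ k {x y} → Dist (Adj G) k v x → InTree y →
         Σ[ p ∈ GraphPath tree x y ] (∀ {z} → OnPath x y z → z liesOn p)
  path k {x} {y} dx (m , dy) with Anc? y x
  ... | yes a with o , refl ← ℕ.m≤n⇒∃[o]m+o≡n (level-≤ a dx dy)
              with p , _ , complete ← pathDown o dx (dist-≡ (ℕ.+-comm k o) dy) a =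
    p , λ { (inj₁ xz , top) → complete (trans-≼ a xz) (top x (refl-≼ dx) a)
          ; (inj₂ yz , top) → complete yz (top x (refl-≼ dx) a) }
  path zero dx (m , dy) | no ¬a with refl ← dist-zero dx = contradiction (root-≼ dy) ¬a
  path (suc k) {x} {y} dx ty | no ¬a with q , dq , par@(a , _) ← parentOf dx
    with p , complete ← path k dq ty =
    cons (inj₁ par) p x∉ , λ {z} → complete′ {z} (z ≟ x)
    where
    x∉ : x ∉ vertices (walk p)
    x∉ x∈ with path-sound (walk p) (simple p) (_ , dq) x∈
    ... | inj₁ b , _ = parent-not-below par b
    ... | inj₂ b , _ = ¬a b
    complete′ : ∀ {z} → Dec (z ≡ x) → OnPath x y z → z ∈ x ∷ vertices (walk p)
    complete′ (yes refl) _ = here refl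
    complete′ {z} (no z≢x) (side , top) = there (complete
      (Sum.map₁ (λ b → anc-parent par b z≢x) side , λ w b → top w (trans-≼ a b)))

  onPath⇔ : ∀ {x y z} → Vertex tree x → Vertex tree y →
            OnPath x y z ⇔ (Σ[ p ∈ GraphPath tree x y ] z liesOn p)
  onPath⇔ tx ty with k , dx ← connected⇒inTree tx with p , complete ← path k dx (connected⇒inTree ty) =
    mk⇔ (λ o → p , complete o) (λ (q , z∈) → path-sound (walk q) (simple q) (k , dx) z∈)

  -- A simple walk that starts upwards ends outside the subtree of `x`, so a closing edge would have
  -- to lead to the parent of `x` again. One that starts downwards ends at least two levels below
  -- `x`, from where no edge leads back.
  acyclic : Acyclic tree
  acyclic record { walk = inj₁ p ◅ w ; simple = u } 2≤ (inj₁ q) = leave p w u (proj₁ q)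
  acyclic record { walk = inj₁ p ◅ ε } (s≤s ()) (inj₂ q)
  acyclic record { walk = inj₁ p ◅ (e ◅ w) ; simple = _ ∷ u } 2≤ (inj₂ q) with refl ← parent-unique p q =
    ∷-∉ u (last-∈ w)
  acyclic record { walk = inj₂ p ◅ w ; simple = u } (s≤s 1≤) e with descend p w u | inTree-upper (proj₁ p)
  ... | between , level | k , dx =
    ℕ.<⇒≱
      (ℕ.≤-trans (ℕ.≤-reflexive (trans (ℕ.+-comm 2 k) (ℕ.+-suc k 1))) (s≤s (ℕ.+-monoʳ-≤ k 1≤)))
      (dist-edge (symmetric G) (edge e) dx (level (parent-level p dx)))
    where
    edge : ∀ {x y} → TreeEdge y x → Adj G x y
    edge (inj₁ (_ , f)) = symmetric G f
    edge (inj₂ (_ , f)) = f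

  isBFSTree : IsBFSTree G v tree
  isBFSTree = record
    { spanningTree = record
      { subgraph = (λ t → t) , λ e → edge e , adj⇒vertex tree e , adj⇒vertex tree (symmetric tree e)
      ; spanning = (λ t → t) , (λ t → t)
      ; isTree   = record
        { connected = λ tx ty → proj₁ (path _ (proj₂ (connected⇒inTree tx)) (connected⇒inTree ty))
        ; acyclic   = acyclic
        }
      }
    ; shortest = λ _ p q → distLeast (level (walk p) (simple p)) (starWalk (walk q))
    }
    where
    edge : ∀ {x y} → TreeEdge x y → Adj G x y
    edge (inj₁ (_ , e)) = e
    edge (inj₂ (_ , e)) = symmetric G e
    level : ∀ {x} (w : Star TreeEdge v x) → Unique (vertices w) → Dist (Adj G) (edgeCount w) v x
    level ε u = dist-refl
    level (inj₁ p ◅ w) u = contradiction (root-≼ (proj₂ (inTree-upper (proj₁ p)))) (parent-not-below p)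
    level (inj₂ p ◅ w) u = proj₂ (descend p w u) (parent-level p dist-refl)

-- Deleting and inserting an edge

module _ {V : Set} {A : Rel V 0ℓ} {v : V} {Anc : Rel V 0ℓ} (ancestry : IsAncestry A v Anc) where

  open IsAncestry ancestry

  record Below (x z : V) : Set where
    constructor between
    field
      {i j} : ℕ
      above : Dist A i v z
      under : Dist A j z x
      full  : Dist A (i + j) v x

  belowDist : ∀ {x z} → Anc x z → Below x z
  belowDist a with i , j , di , dj ← below a = between di (dist-≼ a di dj) dj

joins-swap : ∀ {n} {a b x y : Fin n} → Joins a b x y → Joins a b y x
joins-swap (inj₁ (p , q)) = inj₂ (q , p)
joins-swap (inj₂ (p , q)) = inj₁ (q , p)

joins-same : ∀ {n} {a b x y c d : Fin n} → Joins a b x y → Joins a b c d → (c ≡ x × d ≡ y) ⊎ (c ≡ y × d ≡ x)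
joins-same (inj₁ (refl , refl)) (inj₁ p) = inj₁ p
joins-same (inj₁ (refl , refl)) (inj₂ p) = inj₂ p
joins-same (inj₂ (refl , refl)) (inj₁ p) = inj₂ p
joins-same (inj₂ (refl , refl)) (inj₂ p) = inj₁ p

module Deletion
  {n : ℕ} {A : Rel (Fin n) 0ℓ} (A? : Decidable A) (A-sym : Symmetric A)
  {a b : Fin n} (a≢b : a ≢ b) {v : Fin n} {Anc : Fin n → Rel (Fin n) 0ℓ}
  (ancᵥ : IsAncestry A v (Anc v))
  where

  open IsAncestry

  private V = Fin n

  A′ : Rel V 0ℓ
  A′ x y = A x y × ¬ Joins a b x y

  -- Two adjacent ancestors of `x` are consecutive on its tree path. So these are the vertices below
  -- the deleted edge if it is a tree edge, and there are none if it is absent or outside the tree.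
  S : V → Set
  S x = A a b × Anc v x a × Anc v x b

  module _ (ancₛ : ∀ {r} → S r → IsAncestry A r (Anc r)) where

    longer : ∀ {i j k y} → Dist A (i + j) v y → Dist A (suc i + k) v y → j ≡ suc k
    longer {i} {j} {k} d d′ = ℕ.+-cancelˡ-≡ i _ _ (trans (dist-unique d d′) (sym (ℕ.+-suc i k)))

    -- Every vertex below the edge c d is one further from c than from d, so a path from r
    -- to x cannot be shortest both through c and through d.
    shortcut : ∀ {c d i r x} → S r → Dist A i v c → Dist A (suc i) v d →
               Anc v r c → Anc v r d → Anc v x c → Anc v x d → Anc r x c → ¬ Anc r x d
    shortcut {c} {d} {i} {r} {x} Sr dc dd rc rd xc xd rxc rxd
      with between dd₁ u₁ f₁ ← belowDist ancᵥ rd | between dd₂ u₂ f₂ ← belowDist ancᵥ xd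
         | between dc₁ w₁ g₁ ← belowDist ancᵥ rc | between dc₂ w₂ g₂ ← belowDist ancᵥ xc
         | between rd₁ ud h₁ ← belowDist (ancₛ Sr) rxd | between rc₁ uc h₂ ← belowDist (ancₛ Sr) rxc
      with refl ← dist-unique dc dc₁ | refl ← dist-unique dc dc₂
         | refl ← dist-unique dd dd₁ | refl ← dist-unique dd dd₂
         | refl ← dist-unique u₁ (dist-sym A-sym rd₁) | refl ← dist-unique u₂ ud
         | refl ← dist-unique w₁ (dist-sym A-sym rc₁) | refl ← dist-unique w₂ uc
      with refl ← longer {i} g₁ f₁ | refl ← longer {i} g₂ f₂ =
      ℕ.m≢1+m+n _ (trans (dist-unique h₁ h₂) (cong suc (trans (ℕ.+-suc _ _) (ℕ.+-comm 1 _))))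

    -- Adjacent vertices differ by at most one level, and ancestors of `x` on the same level
    -- coincide; so `shortcut` applies in one of the two orientations.
    ends : ∀ {r x} → S r → S x → Anc r x a → ¬ Anc r x b
    ends {r} {x} Sr@(e , ra , rb) (_ , xa , xb) rxa rxb
      with between {i} da _ _ ← belowDist ancᵥ xa | between {j} db _ _ ← belowDist ancᵥ xb
      with ℕ.<-cmp i j
    ... | tri≈ _ refl _ = a≢b (unique ancᵥ xa xb da db)
    ... | tri< lt _ _ with refl ← ℕ.≤-antisym (dist-edge A-sym e da db) lt =
      shortcut {i = i} Sr da db ra rb xa xb rxa rxb
    ... | tri> _ _ gt with refl ← ℕ.≤-antisym (dist-edge A-sym (A-sym e) db da) gt =
      shortcut {i = j} Sr db da rb ra xb xa rxb rxa

    avoids : ∀ {P : V → Set} → (P a → ¬ P b) → ∀ {y z} → P y → P z → ¬ Joins a b z y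
    avoids f py pz (inj₁ (refl , refl)) = f pz py
    avoids f py pz (inj₂ (refl , refl)) = f py pz

    edge : ∀ {x y z} → ¬ S x → Anc v x y → Anc v x z → A z y → A′ z y
    edge {x} ¬Sx xy xz e = e , λ j → avoids {P = λ w → Anc v x w} (λ xa xb → ¬Sx (joined j e , xa , xb)) xy xz j
      where
      joined : ∀ {z y} → Joins a b z y → A z y → A a b
      joined (inj₁ (refl , refl)) e = e
      joined (inj₂ (refl , refl)) e = A-sym e

    keep : ∀ {k x} → ¬ S x → Dist A k v x → Dist A′ k v x
    keep {k} ¬Sx d = dist
      (treeWalk ancᵥ k (root-≼ ancᵥ d) (edge ¬Sx) dist-refl (dist-≡ (sym (ℕ.+-identityʳ k)) d))
      (λ w → distLeast d (mapWalk proj₁ w))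

    reroutes : Reroutes A A′ v S Anc
    reroutes = record
      { root        = λ (_ , va , vb) → a≢b (trans (sym (≼-v ancᵥ va)) (≼-v ancᵥ vb))
      ; keep        = keep
      ; kept        = kept
      ; outside     = λ ¬Sx xz (e , za , zb) → ¬Sx (e , trans-≼ ancᵥ xz za , trans-≼ ancᵥ xz zb)
      ; outsideEdge = λ ¬Sx xy → edge ¬Sx (refl-≼ ancᵥ (Below.full (belowDist ancᵥ xy))) xy
      ; inside      = λ _ _ → proj₁
      ; insideEdge  = λ {r} {x} Sr Sx xy xz e → e , avoids {P = Anc r x} (ends Sr Sx) xy xz
      }
      where
      kept : ∀ {k x} → ¬ S x → Dist A′ k v x → Dist A k v x
      kept ¬Sx d with m , d′ , _ ← shortest A? (mapWalk proj₁ (distWalk d)) =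
        dist-≡ (dist-unique (keep ¬Sx d′) d) d′

record Near {V : Set} (A : Rel V 0ℓ) (v c d x : V) : Set where
  constructor near
  field
    {i j} : ℕ
    entry : Dist A i v c
    rest  : Dist A j d x
    -- Quantifying over all old distances makes the condition vacuous when `x` was unreachable from
    -- `v`.
    less  : ∀ {m} → Dist A m v x → suc (i + j) < m

Shortened : ∀ {n} → Rel (Fin n) 0ℓ → (a b v x : Fin n) → Set
Shortened A a b v x = ∃[ c ] ∃[ d ] Joins a b c d × Near A v c d x

module Insertion
  {n : ℕ} {A : Rel (Fin n) 0ℓ} (A? : Decidable A)
  {a b : Fin n} {v : Fin n} {Anc : Fin n → Rel (Fin n) 0ℓ}
  (reachable? : ∀ x → Dec (∃[ k ] Dist A k v x))
  (ancᵥ : IsAncestry A v (Anc v))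
  where

  open IsAncestry

  private V = Fin n

  A′ : Rel V 0ℓ
  A′ x y = A x y ⊎ Joins a b x y

  S : V → Set
  S = Shortened A a b v

  data Through (k : ℕ) (x y : V) : Set where
    direct : ∀ {m} → m ≤ k → Walk A m x y → Through k x y
    via    : ∀ {i j c d} → Joins a b c d → suc (i + j) ≤ k →
             Walk A i x c → Walk A j d y → Through k x y

  through : ∀ {k x y} → Walk A′ k x y → Through k x y
  through done = direct z≤n done
  through (step (inj₁ e) w) with through w
  ... | direct m≤ w′    = direct (s≤s m≤) (step e w′)
  ... | via J m≤ w₁ w₂ = via J (s≤s m≤) (step e w₁) w₂
  through (step (inj₂ J) w) with through w
  ... | direct m≤ w′ = via J (s≤s m≤) done w′
  through (step (inj₂ J) w) | via {i} {j} J′ m≤ _ w₂ with joins-same J J′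
  ... | inj₁ (refl , refl) = via J (s≤s (ℕ.≤-trans (ℕ.m≤n+m j (suc i)) m≤)) done w₂
  ... | inj₂ (refl , refl) = direct (ℕ.m≤n⇒m≤1+n (ℕ.≤-trans (ℕ.m≤n+m j (suc i)) m≤)) w₂

  keep : ∀ {k x} → ¬ S x → Dist A k v x → Dist A′ k v x
  keep {k} {x} ¬Sx d = dist (mapWalk inj₁ (distWalk d)) λ w → bound (through w)
    where
    bound : ∀ {j} → Through j v x → k ≤ j
    bound (direct m≤ w) = ℕ.≤-trans (distLeast d w) m≤
    bound (via J m≤ w₁ w₂) with i , di , i≤ ← shortest A? w₁ | j , dj , j≤ ← shortest A? w₂ =
      ℕ.≤-trans (ℕ.≮⇒≥ λ lt → ¬Sx (_ , _ , J , near di dj λ d′ → subst (suc (i + j) <_) (dist-unique d d′) lt))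
        (ℕ.≤-trans (s≤s (ℕ.+-mono-≤ i≤ j≤)) m≤)

  reroutes : Reroutes A A′ v S Anc
  reroutes = record
    { root        = λ (_ , _ , _ , near _ _ less) → ℕ.n≮0 (less dist-refl)
    ; keep        = keep
    ; kept        = kept
    ; outside     = outside
    ; outsideEdge = λ _ _ → inj₁
    ; inside      = inside
    ; insideEdge  = λ _ _ _ _ → inj₁
    }
    where
    kept : ∀ {k x} → ¬ S x → Dist A′ k v x → Dist A k v x
    kept {x = x} ¬Sx d with reachable? x
    ... | yes (m , d′) = dist-≡ (dist-unique (keep ¬Sx d′) d) d′
    -- Here `x` was unreachable, so the new path crosses the new edge. That puts `x` into `S`, with
    -- `less` vacuous.
    ... | no ¬r with through (distWalk d)
    ...   | direct _ w with m , d′ , _ ← shortest A? w = contradiction (m , d′) ¬r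
    ...   | via J _ w₁ w₂ with i , di , _ ← shortest A? w₁ | j , dj , _ ← shortest A? w₂ =
      contradiction (_ , _ , J , near di dj λ d′ → contradiction (_ , d′) ¬r) ¬Sx

    -- A detour that shortens the way to `z` also shortens the way to every `x` below `z`.
    outside : ∀ {x z} → ¬ S x → Anc v x z → ¬ S z
    outside ¬Sx xz (c , d , J , near {i} {j} dc dz less)
      with between {k} {m} vz zx vx ← belowDist ancᵥ xz
      with j₀ , dx , j₀≤ ← shortest A? (distWalk dz ++ʷ distWalk zx) =
      ¬Sx (c , d , J , near dc dx λ d′ → subst (suc (i + j₀) <_) (dist-unique vx d′)
        (ℕ.≤-trans (s≤s (s≤s (ℕ.≤-trans (ℕ.+-monoʳ-≤ i j₀≤) (ℕ.≤-reflexive (sym (ℕ.+-assoc i j m))))))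
                   (ℕ.+-monoˡ-≤ m (less vz))))

    -- The shortcut to an end in `S` arrives from the other end, which was therefore strictly closer
    -- to `v`. Two ends cannot each be closer than the other, whence `inside`.
    closer : ∀ {x y} → Joins a b x y → S x → ∃[ i ] Dist A i v y × (∀ {m} → Dist A m v x → i < m)
    closer J (_ , _ , J′ , near {i} {j} dc _ less) with joins-same J J′
    ... | inj₁ (refl , _) = contradiction (ℕ.m≤m+n i j) (ℕ.<⇒≱ (ℕ.<-trans (ℕ.n<1+n _) (less dc)))
    ... | inj₂ (refl , _) = i , dc , λ d → ℕ.≤-<-trans (ℕ.m≤n⇒m≤1+n (ℕ.m≤m+n i j)) (less d)

    inside : ∀ {x y} → S x → S y → A′ x y → A x y
    inside Sx Sy (inj₁ e) = e
    inside Sx Sy (inj₂ J) with i , dy , x> ← closer J Sx | j , dx , y> ← closer (joins-swap J) Sy =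
      contradiction (x> dx) (ℕ.<-asym (y> dy))

-- Composition of first-order updates

T-does : ∀ {A : Set} (d : Dec A) → T (does d) ⇔ A
T-does (yes p) = mk⇔ (λ _ → p) (λ _ → tt)
T-does (no ¬p) = mk⇔ (λ ()) ¬p

module _ {τ : Vocabulary} where

  Update : Set
  Update = (R : Symbol τ) → Formula τ (2 + arity τ R)

  apply-update : ∀ {n} → Update → Fin n → Fin n → Structure τ n → Structure τ n
  apply-update σ a b M = record { ⟦_⟧ = λ R xs → does (M ⊨? σ R [ a ∷ b ∷ xs ]) }

  holds-update : ∀ {n} (σ : Update) (a b : Fin n) (M : Structure τ n) (R : Symbol τ) xs →
                 Holds (apply-update σ a b M) R xs ⇔ M ⊨ σ R [ a ∷ b ∷ xs ]
  holds-update σ a b M R xs =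
    T-does (M ⊨? σ R [ a ∷ b ∷ xs ])

  lift : ∀ {k m} → (Fin k → Fin m) → Fin (suc k) → Fin (suc m)
  lift f zero    = zero
  lift f (suc i) = suc (f i)

  rename : ∀ {k m} → (Fin k → Fin m) → Formula τ k → Formula τ m
  rename f (atom R is) = atom R (Vec.map f is)
  rename f (i ≈ᶠ j)    = f i ≈ᶠ f j
  rename f (¬ᶠ φ)      = ¬ᶠ rename f φ
  rename f (φ ∧ᶠ ψ)    = rename f φ ∧ᶠ rename f ψ
  rename f (φ ∨ᶠ ψ)    = rename f φ ∨ᶠ rename f ψ
  rename f (∃ᶠ φ)      = ∃ᶠ rename (lift f) φ
  rename f (∀ᶠ φ)      = ∀ᶠ rename (lift f) φ

  module _ {n : ℕ} {M : Structure τ n} where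

    ⊨-rename : ∀ {k m} (f : Fin k → Fin m) (φ : Formula τ k) {ρ : Vec (Fin n) m} {ρ′ : Vec (Fin n) k} →
               (∀ i → lookup ρ (f i) ≡ lookup ρ′ i) →
               M ⊨ rename f φ [ ρ ] ⇔ M ⊨ φ [ ρ′ ]
    ⊨-rename f (atom R is) {ρ} {ρ′} eq = mk⇔ (subst (Holds M R) eqs) (subst (Holds M R) (sym eqs))
      where
      eqs : Vec.map (lookup ρ) (Vec.map f is) ≡ Vec.map (lookup ρ′) is
      eqs = trans (sym (map-∘ (lookup ρ) f is)) (map-cong eq is)
    ⊨-rename f (i ≈ᶠ j) eq = mk⇔ (λ e → trans (sym (eq i)) (trans e (eq j)))
                                   (λ e → trans (eq i) (trans e (sym (eq j))))
    ⊨-rename f (¬ᶠ φ) eq = let e = ⊨-rename f φ eq in mk⇔ (_∘ from e) (_∘ to e)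
    ⊨-rename f (φ ∧ᶠ ψ) eq = let e = ⊨-rename f φ eq ; e′ = ⊨-rename f ψ eq in
      mk⇔ (λ (p , q) → to e p , to e′ q) (λ (p , q) → from e p , from e′ q)
    ⊨-rename f (φ ∨ᶠ ψ) eq = let e = ⊨-rename f φ eq ; e′ = ⊨-rename f ψ eq in
      mk⇔ (Sum.map (to e) (to e′)) (Sum.map (from e) (from e′))
    ⊨-rename f (∃ᶠ φ) {ρ} {ρ′} eq = mk⇔ (λ (x , p) → x , to (e x) p) (λ (x , p) → x , from (e x) p)
      where
      e : ∀ x → M ⊨ rename (lift f) φ [ x ∷ ρ ] ⇔ M ⊨ φ [ x ∷ ρ′ ]
      e x = ⊨-rename (lift f) φ λ { zero → refl ; (suc i) → eq i }
    ⊨-rename f (∀ᶠ φ) {ρ} {ρ′} eq = mk⇔ (λ p x → to (e x) (p x)) (λ p x → from (e x) (p x))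
      where
      e : ∀ x → M ⊨ rename (lift f) φ [ x ∷ ρ ] ⇔ M ⊨ φ [ x ∷ ρ′ ]
      e x = ⊨-rename (lift f) φ λ { zero → refl ; (suc i) → eq i }

  inline : ∀ {k} → Update → Fin k → Fin k → Formula τ k → Formula τ k
  inline σ a b (atom R is) = rename (lookup (a ∷ b ∷ is)) (σ R)
  inline σ a b (i ≈ᶠ j)    = i ≈ᶠ j
  inline σ a b (¬ᶠ φ)      = ¬ᶠ inline σ a b φ
  inline σ a b (φ ∧ᶠ ψ)    = inline σ a b φ ∧ᶠ inline σ a b ψ
  inline σ a b (φ ∨ᶠ ψ)    = inline σ a b φ ∨ᶠ inline σ a b ψ
  inline σ a b (∃ᶠ φ)      = ∃ᶠ inline σ (suc a) (suc b) φ
  inline σ a b (∀ᶠ φ)      = ∀ᶠ inline σ (suc a) (suc b) φ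

  lookup-map₂ : ∀ {n k m} (ρ : Vec (Fin n) k) (is : Vec (Fin k) m) i →
               lookup ρ (lookup is i) ≡ lookup (Vec.map (lookup ρ) is) i
  lookup-map₂ ρ (x ∷ is) zero    = refl
  lookup-map₂ ρ (x ∷ is) (suc i) = lookup-map₂ ρ is i

  module _ {n : ℕ} {M : Structure τ n} (σ : Update) where

    ⊨-inline : ∀ {k} (i j : Fin k) (φ : Formula τ k) (ρ : Vec (Fin n) k) →
               M ⊨ inline σ i j φ [ ρ ] ⇔ apply-update σ (lookup ρ i) (lookup ρ j) M ⊨ φ [ ρ ]
    ⊨-inline i j (atom R is) ρ = mk⇔ (from h ∘ to r) (from r ∘ to h)
      where
      r = ⊨-rename {M = M} (lookup (i ∷ j ∷ is)) (σ R) (lookup-map₂ ρ (i ∷ j ∷ is))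
      h = holds-update σ (lookup ρ i) (lookup ρ j) M R (Vec.map (lookup ρ) is)
    ⊨-inline i j (_ ≈ᶠ _) ρ = mk⇔ (λ e → e) (λ e → e)
    ⊨-inline i j (¬ᶠ φ) ρ = let e = ⊨-inline i j φ ρ in mk⇔ (_∘ from e) (_∘ to e)
    ⊨-inline i j (φ ∧ᶠ ψ) ρ = let e = ⊨-inline i j φ ρ ; e′ = ⊨-inline i j ψ ρ in
      mk⇔ (λ (p , q) → to e p , to e′ q) (λ (p , q) → from e p , from e′ q)
    ⊨-inline i j (φ ∨ᶠ ψ) ρ = let e = ⊨-inline i j φ ρ ; e′ = ⊨-inline i j ψ ρ in
      mk⇔ (Sum.map (to e) (to e′)) (Sum.map (from e) (from e′))
    ⊨-inline i j (∃ᶠ φ) ρ = mk⇔ (λ (x , p) → x , to (⊨-inline (suc i) (suc j) φ (x ∷ ρ)) p)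
                                (λ (x , p) → x , from (⊨-inline (suc i) (suc j) φ (x ∷ ρ)) p)
    ⊨-inline i j (∀ᶠ φ) ρ = mk⇔ (λ p x → to (⊨-inline (suc i) (suc j) φ (x ∷ ρ)) (p x))
                                (λ p x → from (⊨-inline (suc i) (suc j) φ (x ∷ ρ)) (p x))

  infixr 5 _⨾_

  -- Replacing atoms by their defining formulas turns two stages for the same request into one
  -- update. So a request may be processed in any fixed number of stages.
  _⨾_ : Update → Update → Update
  (σ ⨾ θ) R = inline σ zero (suc zero) (θ R)

  holds-⨾ : ∀ {n} (σ θ : Update) (a b : Fin n) (M : Structure τ n) R xs →
            Holds (apply-update (σ ⨾ θ) a b M) R xs ⇔
            Holds (apply-update θ a b (apply-update σ a b M)) R xs
  holds-⨾ σ θ a b M R xs = mk⇔ (from l ∘ to m ∘ to r) (from r ∘ from m ∘ to l)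
    where
    l = holds-update θ a b (apply-update σ a b M) R xs
    m = ⊨-inline {M = M} σ zero (suc zero) (θ R) (a ∷ b ∷ xs)
    r = holds-update (σ ⨾ θ) a b M R xs

-- The dynamic program

auxiliaries : List ℕ
auxiliaries = 3 ∷ 3 ∷ 2 ∷ 6 ∷ 3 ∷ 4 ∷ []

τ : Vocabulary
τ = bfsVocabulary auxiliaries

-- Plus i j l: the ranks satisfy i + j + 1 = l.  Anc v x z: z lies on the path from v to x
-- in the tree of v.  Moved v x: x belongs to the set S of v.  The other three hold the
-- candidates, distances and choices computed within a request.
pattern Plus   = auxiliary 0F
pattern Anc    = auxiliary 1F
pattern Moved  = auxiliary 2F
pattern Cand   = auxiliary 3F
pattern Level⁺ = auxiliary 4F
pattern Choice = auxiliary 5F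

unchanged : Update {τ}
unchanged R = atom R (tabulate (2 ↑ʳ_))

usedᶠ : ∀ {k} → Fin k → Formula τ k
usedᶠ i = atom O (i ∷ i ∷ [])

_<ᶠ_ : ∀ {k} → Fin k → Fin k → Formula τ k
i <ᶠ j = atom O (i ∷ j ∷ []) ∧ᶠ (¬ᶠ (i ≈ᶠ j))

leastᶠ : ∀ {k} → Fin k → Formula τ k
leastᶠ i = usedᶠ i ∧ᶠ (∀ᶠ ((¬ᶠ usedᶠ 0F) ∨ᶠ atom O (suc i ∷ 0F ∷ [])))

successorᶠ : ∀ {k} → Fin k → Fin k → Formula τ k
successorᶠ i j = (i <ᶠ j) ∧ᶠ (∀ᶠ ((¬ᶠ (0F <ᶠ suc j)) ∨ᶠ atom O (0F ∷ suc i ∷ [])))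

append : Fin 2 → Update {τ}
append c O = atom O (2F ∷ 3F ∷ []) ∨ᶠ ((¬ᶠ usedᶠ (c ↑ˡ 2)) ∧ᶠ ((3F ≈ᶠ (c ↑ˡ 2)) ∧ᶠ (usedᶠ 2F ∨ᶠ (2F ≈ᶠ (c ↑ˡ 2)))))
append c R = unchanged R

-- One application extends Plus by one rank; an insertion adds up to two.
grow : Update {τ}
grow Level = atom Level (2F ∷ 3F ∷ 4F ∷ []) ∨ᶠ ((2F ≈ᶠ 3F) ∧ᶠ (usedᶠ 2F ∧ᶠ leastᶠ 4F))
grow Anc   = atom Anc (2F ∷ 3F ∷ 4F ∷ []) ∨ᶠ (usedᶠ 2F ∧ᶠ ((2F ≈ᶠ 3F) ∧ᶠ (2F ≈ᶠ 4F)))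
grow Plus  = atom Plus (2F ∷ 3F ∷ 4F ∷ []) ∨ᶠ ((leastᶠ 3F ∧ᶠ successorᶠ 2F 4F) ∨ᶠ
             (∃ᶠ ∃ᶠ (successorᶠ 1F 5F ∧ᶠ (successorᶠ 0F 6F ∧ᶠ atom Plus (4F ∷ 1F ∷ 0F ∷ [])))))
grow R     = unchanged R

module _ {n : ℕ} (M : Structure τ n) where

  Edgeᴹ Oᴹ Movedᴹ : Fin n → Fin n → Set
  Edgeᴹ  x y = Holds M Edge (x ∷ y ∷ [])
  Oᴹ     x y = Holds M O (x ∷ y ∷ [])
  Movedᴹ x y = Holds M Moved (x ∷ y ∷ [])

  Levelᴹ Plusᴹ Ancᴹ : Fin n → Fin n → Fin n → Set
  Levelᴹ x y z = Holds M Level (x ∷ y ∷ z ∷ [])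
  Plusᴹ  x y z = Holds M Plus (x ∷ y ∷ z ∷ [])
  Ancᴹ   x y z = Holds M Anc (x ∷ y ∷ z ∷ [])

-- Ranks of used vertices as numbers.

data Splitting {V : Set} (A : Rel V 0ℓ) (i j : ℕ) (x y : V) : Set where
  splitting : ∀ {z} → Walk A i x z → Walk A j z y → Splitting A i j x y

splitWalk : ∀ {V : Set} {A : Rel V 0ℓ} i {j x y} → Walk A (i + j) x y → Splitting A i j x y
splitWalk zero    w          = splitting done w
splitWalk (suc i) (step e w) with splitting u v ← splitWalk i w = splitting (step e u) v

walk-closed : ∀ {V : Set} {A : Rel V 0ℓ} {U : Pred V 0ℓ} → (∀ {x y} → A x y → U y) →
              ∀ {k x y} → U x → Walk A k x y → U y
walk-closed closed u done       = u
walk-closed closed u (step e w) = walk-closed closed (closed e) w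

record Ordered {n} (M : Structure τ n) (rk : Fin n → ℕ) (N : ℕ) (U : Pred (Fin n) 0ℓ) : Set where
  field
    O⇔            : ∀ {x y} → Oᴹ M x y ⇔ (U x × U y × rk x ≤ rk y)
    rk<N          : ∀ {x} → U x → rk x < N
    rk-injective  : ∀ {x y} → U x → U y → rk x ≡ rk y → x ≡ y
    rk-surjective : ∀ {k} → k < N → ∃[ x ] U x × rk x ≡ k

  used⇔ : ∀ {x} → Oᴹ M x x ⇔ U x
  used⇔ = mk⇔ (proj₁ ∘ to O⇔) (λ u → from O⇔ (u , u , ℕ.≤-refl))

  U? : U.Decidable U
  U? x = map′ (to used⇔) (from used⇔) (T? _)

  <⇔ : ∀ {x y} → U x → U y → (Oᴹ M x y × x ≢ y) ⇔ rk x < rk y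
  <⇔ ux uy = mk⇔
    (λ (o , x≢y) → ℕ.≤∧≢⇒< (proj₂ (proj₂ (to O⇔ o))) (x≢y ∘ rk-injective ux uy))
    (λ lt → from O⇔ (ux , uy , ℕ.<⇒≤ lt) , λ { refl → ℕ.<-irrefl refl lt })

  -- A shortest walk of length `k` visits used vertices at all distances from 0 to `k`. They are
  -- distinct, so their ranks are `k + 1` different numbers below `N`. Thus every distance is a
  -- rank.
  bounded : ∀ {A : Rel (Fin n) 0ℓ} {k v x} → (∀ {x y} → A x y → U y) → U v → Dist A k v x → k < N
  bounded {A} {k} {v} {x} closed uv d with k ℕ.<? N
  ... | yes k<N = k<N
  ... | no k≮N = ⊥-elim (collision (Fin.pigeonhole (s≤s (ℕ.≮⇒≥ k≮N)) code))
    where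
    at : (i : Fin (suc k)) → ∃[ z ] U z × Dist A (toℕ i) v z
    at i with m , eq ← ℕ.m≤n⇒∃[o]m+o≡n (Fin.toℕ≤pred[n] i)
      with d′ ← dist-≡ (sym eq) d with splitting w w′ ← splitWalk (toℕ i) (distWalk d′)
      with dz ← dist-prefix w w′ d′ = _ , walk-closed closed uv w , dz
    code : Fin (suc k) → Fin N
    code i = fromℕ< (rk<N (proj₁ (proj₂ (at i))))
    collision : ¬ (∃[ i ] ∃[ j ] toℕ i < toℕ j × code i ≡ code j)
    collision (i , j , i<j , eq) with at i | at j | cong toℕ eq
    ... | z , uz , dz | z′ , uz′ , dz′ | eq′
      rewrite Fin.toℕ-fromℕ< (rk<N uz) | Fin.toℕ-fromℕ< (rk<N uz′)
      with refl ← rk-injective uz uz′ eq′ = ℕ.<-irrefl (dist-unique dz dz′) i<j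

  least⇔ : ∀ {k} (ρ : Vec (Fin n) k) i → M ⊨ leastᶠ i [ ρ ] ⇔ (U (Vec.lookup ρ i) × rk (Vec.lookup ρ i) ≡ 0)
  least⇔ ρ i = mk⇔ sound complete
    where
    x = Vec.lookup ρ i
    sound : M ⊨ leastᶠ i [ ρ ] → U x × rk x ≡ 0
    sound (o , f) with u ← to used⇔ o
      with z , uz , eq ← rk-surjective (ℕ.≤-<-trans z≤n (rk<N u)) with f z
    ... | inj₁ ¬o = contradiction (from used⇔ uz) ¬o
    ... | inj₂ o′ = u , ℕ.n≤0⇒n≡0 (subst (rk x ≤_) eq (proj₂ (proj₂ (to O⇔ o′))))
    complete : U x × rk x ≡ 0 → M ⊨ leastᶠ i [ ρ ]
    complete (u , eq) = from used⇔ u , above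
      where
      above : ∀ w → (¬ Oᴹ M w w) ⊎ Oᴹ M x w
      above w with U? w
      ... | yes uw = inj₂ (from O⇔ (u , uw , subst (_≤ rk w) (sym eq) z≤n))
      ... | no ¬uw = inj₁ (¬uw ∘ to used⇔)

  successor⇔ : ∀ {k} (ρ : Vec (Fin n) k) i j → M ⊨ successorᶠ i j [ ρ ] ⇔
               (U (Vec.lookup ρ i) × U (Vec.lookup ρ j) × suc (rk (Vec.lookup ρ i)) ≡ rk (Vec.lookup ρ j))
  successor⇔ ρ i j = mk⇔ sound complete
    where
    x = Vec.lookup ρ i
    y = Vec.lookup ρ j
    sound : M ⊨ successorᶠ i j [ ρ ] → U x × U y × suc (rk x) ≡ rk y
    sound (lt@(o , _) , f) with ux , uy , _ ← to O⇔ o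
      with x<y ← to (<⇔ ux uy) lt with ℕ.m≤n⇒m<n∨m≡n x<y
    ... | inj₂ eq = ux , uy , eq
    ... | inj₁ gap with z , uz , eq ← rk-surjective (ℕ.<-trans gap (rk<N uy)) with f z
    ...   | inj₁ ¬lt = contradiction (from (<⇔ uz uy) (subst (_< rk y) (sym eq) gap)) ¬lt
    ...   | inj₂ o′  = contradiction (proj₂ (proj₂ (to O⇔ o′))) (ℕ.<⇒≱ (ℕ.≤-reflexive (sym eq)))
    complete : U x × U y × suc (rk x) ≡ rk y → M ⊨ successorᶠ i j [ ρ ]
    complete (ux , uy , eq) = from (<⇔ ux uy) (ℕ.≤-reflexive eq) , below
      where
      below : ∀ w → (¬ (Oᴹ M w y × w ≢ y)) ⊎ Oᴹ M w x
      below w with U? w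
      ... | no ¬uw = inj₁ (λ (o , _) → ¬uw (proj₁ (to O⇔ o)))
      ... | yes uw with rk w ℕ.≤? rk x
      ...   | yes le = inj₂ (from O⇔ (uw , ux , le))
      ...   | no ¬le = inj₁ (λ lt → ¬le (s≤s⁻¹ (subst (rk w <_) (sym eq) (to (<⇔ uw uy) lt))))

isAncestry-cong : ∀ {V : Set} {A : Rel V 0ℓ} {v : V} {R R′ : Rel V 0ℓ} → R ⇒ R′ → R′ ⇒ R →
                  IsAncestry A v R → IsAncestry A v R′
isAncestry-cong f g anc = record
  { below   = λ a → below (g a)
  ; refl-≼  = λ d → f (refl-≼ d)
  ; trans-≼ = λ a b → f (trans-≼ (g a) (g b))
  ; unique  = λ a b → unique (g a) (g b)
  ; parent  = λ d → let y , dy , e , a = parent d in y , dy , e , f a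
  }
  where open IsAncestry anc

-- Level and Anc are complete only from roots in U₀, and Plus only up to rank K.
record State {n} (M : Structure τ n) (rk : Fin n → ℕ) (N : ℕ) (U₀ U : Pred (Fin n) 0ℓ)
             (A : Rel (Fin n) 0ℓ) (K : ℕ) : Set where
  field
    ordered  : Ordered M rk N U
    old      : ∀ {x} → U₀ x → U x
    edge⇔    : ∀ {x y} → Edgeᴹ M x y ⇔ A x y
    A-sym    : Symmetric A
    A-used   : ∀ {x y} → A x y → U₀ x
    plus     : ∀ {i j l} → Plusᴹ M i j l → U i × U j × U l × suc (rk i + rk j) ≡ rk l
    plus⁻    : ∀ {i j l} → U i → U j → U l → suc (rk i + rk j) ≡ rk l → rk l < K → Plusᴹ M i j l
    level    : ∀ {v x l} → Levelᴹ M v x l → U v × U l × Dist A (rk l) v x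
    level⁻   : ∀ {v x l} → U₀ v → U l → Dist A (rk l) v x → Levelᴹ M v x l
    ancestry : ∀ {v} → U₀ v → IsAncestry A v (Ancᴹ M v)
    anc-used : ∀ {v x z} → Ancᴹ M v x z → U₀ v

  open Ordered ordered public

  A? : Decidable A
  A? x y = map′ (to edge⇔) (from edge⇔) (T? _)

  U₀? : U.Decidable U₀
  U₀? v = map′ anc-used (λ u → IsAncestry.refl-≼ (ancestry u) dist-refl) (T? (⟦ M ⟧ Anc (v ∷ v ∷ v ∷ [])))

  A-used′ : ∀ {x y} → A x y → U y
  A-used′ e = old (A-used (A-sym e))

module _ {n} {M : Structure τ n} {rk N U₀ U A K} (state : State M rk N U₀ U A K) (a b : Fin n) where

  open State state

  grown : State (apply-update grow a b M) rk N U U A (suc K)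
  grown = record
    { ordered  = record { O⇔ = O⇔ ; rk<N = rk<N ; rk-injective = rk-injective ; rk-surjective = rk-surjective }
    ; old      = λ u → u
    ; edge⇔    = edge⇔
    ; A-sym    = A-sym
    ; A-used   = old ∘ A-used
    ; plus     = plus′ ∘ to Plus⇔
    ; plus⁻    = λ ui uj ul eq lt → from Plus⇔ (plus⁻′ ui uj ul eq (s≤s⁻¹ lt))
    ; level    = level′ ∘ to Level⇔
    ; level⁻   = λ uv ul d → from Level⇔ (level⁻′ uv ul d)
    ; ancestry = λ {v} uv → ancestry′ uv
    ; anc-used = anc-used′ ∘ to Anc⇔
    }
    where
    M′ = apply-update grow a b M

    Loop : Fin n → Fin n → Fin n → Set
    Loop v x l = v ≡ x × U v × U l × rk l ≡ 0

    Level⇔ : ∀ {v x l} → Levelᴹ M′ v x l ⇔ (Levelᴹ M v x l ⊎ Loop v x l)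
    Level⇔ {v} {x} {l} = mk⇔
      (Sum.map₂ (λ (eq , o , p) → eq , to used⇔ o , to (least⇔ ρ 4F) p) ∘ to h)
      (from h ∘ Sum.map₂ (λ (eq , uv , p) → eq , from used⇔ uv , from (least⇔ ρ 4F) p))
      where
      ρ = a ∷ b ∷ v ∷ x ∷ l ∷ []
      h = holds-update grow a b M Level (v ∷ x ∷ l ∷ [])

    Trivial : Fin n → Fin n → Fin n → Set
    Trivial v x z = Oᴹ M v v × v ≡ x × v ≡ z

    Anc⇔ : ∀ {v x z} → Ancᴹ M′ v x z ⇔ (Ancᴹ M v x z ⊎ Trivial v x z)
    Anc⇔ {v} {x} {z} = holds-update grow a b M Anc (v ∷ x ∷ z ∷ [])

    Next : Fin n → Fin n → Set
    Next i j = U i × U j × suc (rk i) ≡ rk j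

    PlusStep : Fin n → Fin n → Fin n → Set
    PlusStep i j l = Plusᴹ M i j l ⊎ ((U j × rk j ≡ 0) × Next i l) ⊎
                     (∃[ j′ ] ∃[ l′ ] Next j′ j × Next l′ l × Plusᴹ M i j′ l′)

    Plus⇔ : ∀ {i j l} → Plusᴹ M′ i j l ⇔ PlusStep i j l
    Plus⇔ {i} {j} {l} = mk⇔
      (Sum.map₂ (Sum.map
        (λ (p , q) → to (least⇔ ρ 3F) p , to (successor⇔ ρ 2F 4F) q)
        (λ (j′ , l′ , p , q , r) → j′ , l′ ,
          to (successor⇔ (l′ ∷ j′ ∷ ρ) 1F 5F) p , to (successor⇔ (l′ ∷ j′ ∷ ρ) 0F 6F) q , r)) ∘ to h)
      (from h ∘ Sum.map₂ (Sum.map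
        (λ (p , q) → from (least⇔ ρ 3F) p , from (successor⇔ ρ 2F 4F) q)
        (λ (j′ , l′ , p , q , r) → j′ , l′ ,
          from (successor⇔ (l′ ∷ j′ ∷ ρ) 1F 5F) p , from (successor⇔ (l′ ∷ j′ ∷ ρ) 0F 6F) q , r)))
      where
      ρ = a ∷ b ∷ i ∷ j ∷ l ∷ []
      h = holds-update grow a b M Plus (i ∷ j ∷ l ∷ [])

    plus′ : ∀ {i j l} → PlusStep i j l → U i × U j × U l × suc (rk i + rk j) ≡ rk l
    plus′ (inj₁ p) = plus p
    plus′ {i} (inj₂ (inj₁ ((uj , j≡0) , (ui , ul , eq)))) =
      ui , uj , ul , trans (cong suc (trans (cong (rk i +_) j≡0) (ℕ.+-identityʳ _))) eq
    plus′ {i} (inj₂ (inj₂ (j′ , l′ , (_ , uj , j≡) , (_ , ul , l≡) , p))) with ui , _ , _ , eq ← plus p =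
      ui , uj , ul , trans (cong suc (trans (cong (rk i +_) (sym j≡)) (trans (ℕ.+-suc _ _) eq))) l≡

    plus⁻′ : ∀ {i j l} → U i → U j → U l → suc (rk i + rk j) ≡ rk l → rk l ≤ K → PlusStep i j l
    plus⁻′ {i} {j} {l} ui uj ul eq le with rk j in j≡
    ... | zero = inj₂ (inj₁ ((uj , refl) , (ui , ul , trans (cong suc (sym (ℕ.+-identityʳ _))) eq)))
    -- Lowering both `j` and `l` by one gives a sum below `K`, which is already stored.
    ... | suc q with j′ , uj′ , refl ← rk-surjective {q} (ℕ.<-trans (ℕ.n<1+n q) (subst (_< N) j≡ (rk<N uj)))
                   | l′ , ul′ , l′≡ ← rk-surjective (ℕ.≤-trans (ℕ.≤-reflexive eq) (ℕ.<⇒≤ (rk<N ul))) =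
      inj₂ (inj₂ (j′ , l′ , (uj′ , uj , refl) , (ul′ , ul , trans (cong suc l′≡) eq) ,
        plus⁻ ui uj′ ul′ (trans (sym (ℕ.+-suc _ _)) (sym l′≡))
          (ℕ.<-≤-trans (ℕ.≤-reflexive (trans (cong suc l′≡) eq)) le)))

    level′ : ∀ {v x l} → Levelᴹ M v x l ⊎ Loop v x l → U v × U l × Dist A (rk l) v x
    level′ (inj₁ p) = level p
    level′ (inj₂ (refl , uv , ul , l≡0)) = uv , ul , dist-≡ (sym l≡0) dist-refl

    -- All edges join vertices of `U₀`. So a vertex used for the first time has a tree consisting of
    -- its root alone, which is what `grow` adds.
    isolated : ∀ {k v x} → ¬ U₀ v → Dist A k v x → v ≡ x × k ≡ 0
    isolated ¬u (dist done _)       = refl , refl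
    isolated ¬u (dist (step e _) _) = contradiction (A-used e) ¬u

    level⁻′ : ∀ {v x l} → U v → U l → Dist A (rk l) v x → Levelᴹ M v x l ⊎ Loop v x l
    level⁻′ {v} uv ul d with U₀? v
    ... | yes u₀ = inj₁ (level⁻ u₀ ul d)
    ... | no ¬u₀ with refl , l≡0 ← isolated ¬u₀ d = inj₂ (refl , uv , ul , l≡0)

    anc-used′ : ∀ {v x z} → Ancᴹ M v x z ⊎ Trivial v x z → U v
    anc-used′ {v} {x} {z} (inj₁ p) = old (anc-used p)
    anc-used′ (inj₂ (o , _)) = to used⇔ o

    ancestry′ : ∀ {v} → U v → IsAncestry A v (Ancᴹ M′ v)
    ancestry′ {v} uv with U₀? v
    ... | yes u₀ = isAncestry-cong (from Anc⇔ ∘ inj₁)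
                     (Sum.[ (λ p → p) , (λ { (_ , refl , refl) → IsAncestry.refl-≼ (ancestry u₀) dist-refl }) ] ∘ to Anc⇔)
                     (ancestry u₀)
    ... | no ¬u₀ = record
      { below   = λ a → below (to Anc⇔ a)
      ; refl-≼  = λ d → root (isolated ¬u₀ d)
      ; trans-≼ = λ p q → trans′ (to Anc⇔ p) (to Anc⇔ q)
      ; unique  = λ p q _ _ → unique (to Anc⇔ p) (to Anc⇔ q)
      ; parent  = λ d → contradiction (proj₂ (isolated ¬u₀ d)) λ ()
      }
      where
      below : ∀ {x z} → Ancᴹ M v x z ⊎ Trivial v x z → ∃[ i ] ∃[ j ] Dist A i v z × Dist A (i + j) v x
      below {x} {z} (inj₁ p) = contradiction (anc-used p) ¬u₀
      below (inj₂ (_ , refl , refl)) = 0 , 0 , dist-refl , dist-refl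
      root : ∀ {k x} → v ≡ x × k ≡ 0 → Ancᴹ M′ v x x
      root (refl , _) = from Anc⇔ (inj₂ (from used⇔ uv , refl , refl))
      trans′ : ∀ {x y z} → Ancᴹ M v x y ⊎ Trivial v x y → Ancᴹ M v y z ⊎ Trivial v y z → Ancᴹ M′ v x z
      trans′ (inj₁ p) _ = contradiction (anc-used p) ¬u₀
      trans′ _ (inj₁ p) = contradiction (anc-used p) ¬u₀
      trans′ (inj₂ (o , refl , refl)) (inj₂ (_ , _ , refl)) = from Anc⇔ (inj₂ (o , refl , refl))
      unique : ∀ {x y z} → Ancᴹ M v x y ⊎ Trivial v x y → Ancᴹ M v x z ⊎ Trivial v x z → y ≡ z
      unique (inj₁ p) _ = contradiction (anc-used p) ¬u₀
      unique _ (inj₁ p) = contradiction (anc-used p) ¬u₀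
      unique (inj₂ (_ , _ , refl)) (inj₂ (_ , _ , refl)) = refl

module _ {n} {M : Structure τ n} {rk N U₀ U A K} (state : State M rk N U₀ U A K)
         (a b : Fin n) (c : Fin 2) (K≤N : K ≤ N) where

  open State state

  private
    M′ = apply-update (append c) a b M
    c₀ = Vec.lookup (a ∷ b ∷ []) c

    U′ : Pred (Fin n) 0ℓ
    U′ x = U x ⊎ x ≡ c₀

    O′⇔ : ∀ {x y} → Oᴹ M′ x y ⇔ (Oᴹ M x y ⊎ (¬ Oᴹ M c₀ c₀) × y ≡ c₀ × (Oᴹ M x x ⊎ x ≡ c₀))
    O′⇔ {x} {y} = by c
      where
      by : ∀ c → let c₀ = Vec.lookup (a ∷ b ∷ []) c in
           Oᴹ (apply-update (append c) a b M) x y ⇔ (Oᴹ M x y ⊎ (¬ Oᴹ M c₀ c₀) × y ≡ c₀ × (Oᴹ M x x ⊎ x ≡ c₀))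
      by 0F = holds-update (append 0F) a b M O (x ∷ y ∷ [])
      by 1F = holds-update (append 1F) a b M O (x ∷ y ∷ [])

  -- A vertex that is new gets the rank `N`. This is no distance, by `bounded`, and is not below
  -- `K`, so completeness of `Level` and `Plus` is not affected.
  appended : ∃[ rk′ ] ∃[ N′ ] N ≤ N′ × N′ ≤ suc N × State M′ rk′ N′ U₀ U′ A K
  appended with U? c₀
  ... | yes uc = rk , N , ℕ.≤-refl , ℕ.n≤1+n N , record
    { ordered  = record
      { O⇔            = mk⇔
        (λ o → Sum.[ (λ o′ → let ux , uy , le = to O⇔ o′ in inj₁ ux , inj₁ uy , le) ,
                     (λ (¬o , _) → contradiction (from used⇔ uc) ¬o) ] (to O′⇔ o))
        (λ (ux , uy , le) → from O′⇔ (inj₁ (from O⇔ (same ux , same uy , le))))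
      ; rk<N          = rk<N ∘ same
      ; rk-injective  = λ ux uy → rk-injective (same ux) (same uy)
      ; rk-surjective = λ k<N → let x , ux , eq = rk-surjective k<N in x , inj₁ ux , eq
      }
    ; old      = inj₁ ∘ old
    ; edge⇔    = edge⇔
    ; A-sym    = A-sym
    ; A-used   = A-used
    ; plus     = λ p → let ui , uj , ul , eq = plus p in inj₁ ui , inj₁ uj , inj₁ ul , eq
    ; plus⁻    = λ ui uj ul → plus⁻ (same ui) (same uj) (same ul)
    ; level    = λ p → let uv , ul , d = level p in inj₁ uv , inj₁ ul , d
    ; level⁻   = λ uv ul → level⁻ uv (same ul)
    ; ancestry = ancestry
    ; anc-used = anc-used
    }
    where
    same : ∀ {x} → U′ x → U x
    same (inj₁ u)    = u
    same (inj₂ refl) = uc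
  ... | no ¬uc = rk′ , suc N , ℕ.n≤1+n N , ℕ.≤-refl , record
    { ordered  = record
      { O⇔            = mk⇔ (sound ∘ to O′⇔) (from O′⇔ ∘ complete)
      ; rk<N          = rk′<
      ; rk-injective  = injective
      ; rk-surjective = λ k< → surjective (ℕ.m≤n⇒m<n∨m≡n (s≤s⁻¹ k<))
      }
    ; old      = inj₁ ∘ old
    ; edge⇔    = edge⇔
    ; A-sym    = A-sym
    ; A-used   = A-used
    ; plus     = λ p → let ui , uj , ul , eq = plus p in inj₁ ui , inj₁ uj , inj₁ ul ,
                   trans (cong suc (cong₂ _+_ (rk-old ui) (rk-old uj))) (trans eq (sym (rk-old ul)))
    ; plus⁻    = plus⁻′
    ; level    = λ p → let uv , ul , d = level p in inj₁ uv , inj₁ ul , dist-≡ (sym (rk-old ul)) d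
    ; level⁻   = level⁻′
    ; ancestry = ancestry
    ; anc-used = anc-used
    }
    where
    rk′ : Fin n → ℕ
    rk′ x with x ≟ c₀
    ... | yes _ = N
    ... | no  _ = rk x

    rk-new : rk′ c₀ ≡ N
    rk-new with c₀ ≟ c₀
    ... | yes _  = refl
    ... | no c≢c = contradiction refl c≢c

    rk-old : ∀ {x} → U x → rk′ x ≡ rk x
    rk-old {x} u with x ≟ c₀
    ... | yes refl = contradiction u ¬uc
    ... | no  _    = refl

    sound : ∀ {x y} → Oᴹ M x y ⊎ (¬ Oᴹ M c₀ c₀) × y ≡ c₀ × (Oᴹ M x x ⊎ x ≡ c₀) → U′ x × U′ y × rk′ x ≤ rk′ y
    sound (inj₁ o) with ux , uy , le ← to O⇔ o rewrite rk-old ux | rk-old uy = inj₁ ux , inj₁ uy , le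
    sound (inj₂ (_ , refl , inj₂ refl)) = inj₂ refl , inj₂ refl , ℕ.≤-refl
    sound (inj₂ (_ , refl , inj₁ o)) with ux ← to used⇔ o =
      inj₁ ux , inj₂ refl ,
      ℕ.≤-trans (ℕ.≤-reflexive (rk-old ux)) (ℕ.≤-trans (ℕ.<⇒≤ (rk<N ux)) (ℕ.≤-reflexive (sym rk-new)))

    complete : ∀ {x y} → U′ x × U′ y × rk′ x ≤ rk′ y → Oᴹ M x y ⊎ (¬ Oᴹ M c₀ c₀) × y ≡ c₀ × (Oᴹ M x x ⊎ x ≡ c₀)
    complete (inj₁ ux , inj₁ uy , le) rewrite rk-old ux | rk-old uy = inj₁ (from O⇔ (ux , uy , le))
    complete (inj₂ refl , inj₁ uy , le) rewrite rk-new | rk-old uy = contradiction le (ℕ.<⇒≱ (rk<N uy))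
    complete (ux , inj₂ refl , _) = inj₂ (¬uc ∘ to used⇔ , refl , Sum.map₁ (from used⇔) ux)

    rk′< : ∀ {x} → U′ x → rk′ x < suc N
    rk′< (inj₁ u) rewrite rk-old u = ℕ.m≤n⇒m≤1+n (rk<N u)
    rk′< (inj₂ refl) rewrite rk-new = ℕ.≤-refl

    injective : ∀ {x y} → U′ x → U′ y → rk′ x ≡ rk′ y → x ≡ y
    injective (inj₁ ux) (inj₁ uy) eq rewrite rk-old ux | rk-old uy = rk-injective ux uy eq
    injective (inj₁ ux) (inj₂ refl) eq rewrite rk-old ux | rk-new = contradiction eq (ℕ.<⇒≢ (rk<N ux))
    injective (inj₂ refl) (inj₁ uy) eq rewrite rk-old uy | rk-new = contradiction (sym eq) (ℕ.<⇒≢ (rk<N uy))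
    injective (inj₂ refl) (inj₂ refl) _ = refl

    surjective : ∀ {k} → k < N ⊎ k ≡ N → ∃[ x ] U′ x × rk′ x ≡ k
    surjective (inj₂ refl) = c₀ , inj₂ refl , rk-new
    surjective (inj₁ k<N) with x , ux , eq ← rk-surjective k<N = x , inj₁ ux , trans (rk-old ux) eq

    below-N : ∀ {x} → U′ x → rk′ x < N → U x
    below-N (inj₁ u) _ = u
    below-N (inj₂ refl) lt = contradiction rk-new (ℕ.<⇒≢ lt)

    plus⁻′ : ∀ {i j l} → U′ i → U′ j → U′ l → suc (rk′ i + rk′ j) ≡ rk′ l → rk′ l < K → Plusᴹ M i j l
    plus⁻′ {i} {j} {l} ui uj ul eq lt = plus⁻ ui° uj° ul°
      (trans (sym (cong suc (cong₂ _+_ (rk-old ui°) (rk-old uj°)))) (trans eq (rk-old ul°)))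
      (subst (_< K) (rk-old ul°) lt)
      where
      l<N = ℕ.<-≤-trans lt K≤N
      sum<N : rk′ i + rk′ j < N
      sum<N = ℕ.≤-trans (ℕ.≤-reflexive eq) (ℕ.<⇒≤ l<N)
      ul° = below-N ul l<N
      ui° = below-N ui (ℕ.≤-<-trans (ℕ.m≤m+n _ _) sum<N)
      uj° = below-N uj (ℕ.≤-<-trans (ℕ.m≤n+m _ (rk′ i)) sum<N)

    level⁻′ : ∀ {v x l} → U₀ v → U′ l → Dist A (rk′ l) v x → Levelᴹ M v x l
    level⁻′ uv ul d = level⁻ uv ul° (dist-≡ (rk-old ul°) d)
      where
      ul° = below-N ul (bounded A-used′ (old uv) d)

-- Rerouting by first-order formulas.

collect : Update {τ}
collect Cand = (¬ᶠ atom Moved (2F ∷ 4F ∷ [])) ∧ᶠ (atom Moved (2F ∷ 5F ∷ []) ∧ᶠ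
  (atom Edge (4F ∷ 5F ∷ []) ∧ᶠ (atom Level (5F ∷ 3F ∷ 6F ∷ []) ∧ᶠ
  -- The offset in `Plus` counts the edge from `p` to `r`.
  (∃ᶠ (atom Level (3F ∷ 5F ∷ 0F ∷ []) ∧ᶠ atom Plus (0F ∷ 7F ∷ 8F ∷ []))))))
collect R = unchanged R

someCandᶠ : ∀ {k} → Fin k → Fin k → Fin k → Formula τ k
someCandᶠ v x l = ∃ᶠ ∃ᶠ ∃ᶠ atom Cand ((3 ↑ʳ v) ∷ (3 ↑ʳ x) ∷ 2F ∷ 1F ∷ 0F ∷ (3 ↑ʳ l) ∷ [])

measure : Update {τ}
measure Level⁺ = ((¬ᶠ atom Moved (2F ∷ 3F ∷ [])) ∧ᶠ atom Level (2F ∷ 3F ∷ 4F ∷ [])) ∨ᶠ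
  (atom Moved (2F ∷ 3F ∷ []) ∧ᶠ (someCandᶠ 2F 3F 4F ∧ᶠ (¬ᶠ (∃ᶠ ((0F <ᶠ 5F) ∧ᶠ someCandᶠ 3F 4F 0F)))))
measure R = unchanged R

-- Outside the negation, `0F` and `1F` are `j` and `l`. Inside it, `0F`, `1F`, `2F` are the
-- competing `j′`, `r′`, `p′`, while `3F`, `9F` and `suc 9F` are `j`, `p` and `r`.
choose : Update {τ}
choose Choice = ∃ᶠ ∃ᶠ (atom Level⁺ (4F ∷ 5F ∷ 1F ∷ []) ∧ᶠ (atom Cand (4F ∷ 5F ∷ 6F ∷ 7F ∷ 0F ∷ 1F ∷ []) ∧ᶠ
  (¬ᶠ (∃ᶠ ∃ᶠ ∃ᶠ (atom Cand (7F ∷ 8F ∷ 2F ∷ 1F ∷ 0F ∷ 4F ∷ []) ∧ᶠ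
    ((0F <ᶠ 3F) ∨ᶠ ((0F ≈ᶠ 3F) ∧ᶠ ((2F <ᶠ 9F) ∨ᶠ ((2F ≈ᶠ 9F) ∧ᶠ (1F <ᶠ suc 9F))))))))))
choose R = unchanged R

commit : Update {τ}
commit Level = atom Level⁺ (2F ∷ 3F ∷ 4F ∷ [])
commit Anc   = ((¬ᶠ atom Moved (2F ∷ 3F ∷ [])) ∧ᶠ atom Anc (2F ∷ 3F ∷ 4F ∷ [])) ∨ᶠ
  (atom Moved (2F ∷ 3F ∷ []) ∧ᶠ (∃ᶠ ∃ᶠ (atom Choice (4F ∷ 5F ∷ 1F ∷ 0F ∷ []) ∧ᶠ
    (atom Anc (4F ∷ 1F ∷ 6F ∷ []) ∨ᶠ atom Anc (0F ∷ 5F ∷ 6F ∷ [])))))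
commit R     = unchanged R

-- Edge already describes the new graph A′, while Level and Anc still describe A.
record Ready {n} (M : Structure τ n) (rk : Fin n → ℕ) (N : ℕ) (U : Pred (Fin n) 0ℓ)
             (A A′ : Rel (Fin n) 0ℓ) : Set where
  field
    ordered      : Ordered M rk N U
    edge⇔        : ∀ {x y} → Edgeᴹ M x y ⇔ A′ x y
    A?           : Decidable A
    A′-sym       : Symmetric A′
    A′-used      : ∀ {x y} → A′ x y → U x
    plus⇔        : ∀ {i j l} → Plusᴹ M i j l ⇔ (U i × U j × U l × suc (rk i + rk j) ≡ rk l)
    level⇔       : ∀ {v x l} → Levelᴹ M v x l ⇔ (U v × U l × Dist A (rk l) v x)
    A-used       : ∀ {x y} → A x y → U y
    ancestry     : ∀ {v} → U v → IsAncestry A v (Ancᴹ M v)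
    anc-used     : ∀ {v x z} → Ancᴹ M v x z → U v
    moved-used   : ∀ {v x} → Movedᴹ M v x → U v × U x
    reroutes     : ∀ {v} → U v → Reroutes A A′ v (Movedᴹ M v) (Ancᴹ M)

  open Ordered ordered public

module _ {n} {M : Structure τ n} {rk N U A A′} (ready : Ready M rk N U A A′) (a b : Fin n) where

  open Ready ready

  M₁ = apply-update collect a b M
  M₂ = apply-update measure a b M₁
  M₃ = apply-update choose  a b M₂
  M₄ = apply-update commit  a b M₃

  Candᴹ : (v x p r j l : Fin n) → Set
  Candᴹ v x p r j l = Holds M₁ Cand (v ∷ x ∷ p ∷ r ∷ j ∷ l ∷ [])

  moved? : ∀ v → U.Decidable (Movedᴹ M v)
  moved? v x = T? (⟦ M ⟧ Moved (v ∷ x ∷ []))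

  A′? : Decidable A′
  A′? x y = map′ (to edge⇔) (from edge⇔) (T? _)

  module _ {v : Fin n} (uv : U v) where

    open Reroute {A = A} A? A′? (moved? v) (ancestry uv)
      (λ Sr → ancestry (proj₂ (moved-used Sr))) rk
      (λ e f → rk-injective (A′-used e) (A′-used f)) A′-sym (reroutes uv)

    private
      S : Pred (Fin n) 0ℓ
      S = Movedᴹ M v

    cand⇔ : ∀ {x p r j l} → Candᴹ v x p r j l ⇔ (U j × U l × Candidate x p r (rk j) (rk l))
    cand⇔ {x} {p} {r} {j} {l} = mk⇔ (sound ∘ to h) (from h ∘ complete)
      where
      h = holds-update collect a b M Cand (v ∷ x ∷ p ∷ r ∷ j ∷ l ∷ [])
      Body : Set
      Body = (¬ S p) × S r × Edgeᴹ M p r × Levelᴹ M r x j × (∃[ i ] Levelᴹ M v p i × Plusᴹ M i j l)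
      sound : Body → U j × U l × Candidate x p r (rk j) (rk l)
      sound (¬Sp , Sr , e , lj , i , li , pl)
        with _ , uj , dj ← to level⇔ lj | _ , _ , di ← to level⇔ li | _ , _ , ul , eq ← to plus⇔ pl =
        uj , ul , candidate ¬Sp Sr (to edge⇔ e) di dj (trans (ℕ.+-suc _ _) eq)
      complete : U j × U l × Candidate x p r (rk j) (rk l) → Body
      complete (uj , ul , candidate ¬Sp Sr e di dj eq)
        with i , ui , refl ← rk-surjective (bounded A-used uv di) =
        ¬Sp , Sr , from edge⇔ e , from level⇔ (proj₂ (moved-used Sr) , uj , dj) ,
        i , from level⇔ (uv , ui , di) , from plus⇔ (ui , uj , ul , trans (sym (ℕ.+-suc _ _)) eq)

    -- As an old distance, `j` is the rank of a vertex. The total `l` may exceed all ranks and has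
    -- to be bounded by assumption.
    candᴺ : ∀ {x p r j l} → l < N → Candidate x p r j l →
            ∃[ j′ ] ∃[ l′ ] U j′ × rk j′ ≡ j × U l′ × rk l′ ≡ l × Candᴹ v x p r j′ l′
    candᴺ l<N c
      with j′ , uj , refl ← rk-surjective (bounded A-used (proj₂ (moved-used (Candidate.inner c))) (Candidate.rest c))
         | l′ , ul , refl ← rk-surjective l<N =
      j′ , l′ , uj , refl , ul , refl , from cand⇔ (uj , ul , c)

    level⁺⇔ : ∀ {x l} → Holds M₂ Level⁺ (v ∷ x ∷ l ∷ []) ⇔ (U l × Dist A′ (rk l) v x)
    level⁺⇔ {x} {l} = mk⇔ (sound ∘ to h) (from h ∘ complete)
      where
      h = holds-update measure a b M₁ Level⁺ (v ∷ x ∷ l ∷ [])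
      Some : Fin n → Set
      Some l = ∃[ p ] ∃[ r ] ∃[ j ] Candᴹ v x p r j l
      Body : Set
      Body = ((¬ S x) × Levelᴹ M v x l) ⊎ (S x × Some l × ¬ (∃[ m ] (Oᴹ M m l × m ≢ l) × Some m))
      sound : Body → U l × Dist A′ (rk l) v x
      sound (inj₁ (¬Sx , ll)) with _ , ul , d ← to level⇔ ll = ul , Reroutes.keep (reroutes uv) ¬Sx d
      sound (inj₂ (Sx , (p , r , j , c) , min)) with uj , ul , c ← to cand⇔ c =
        -- A candidate with a smaller total is encoded by vertices, because that total is below
        -- `rk l`.
        ul , candidate-dist Sx c λ c′ → ℕ.≮⇒≥ λ lt →
          let _ , l′ , _ , _ , ul′ , eq , c″ = candᴺ (ℕ.<-trans lt (rk<N ul)) c′ in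
          min (l′ , from (<⇔ ul′ ul) (subst (_< rk l) (sym eq) lt) , _ , _ , _ , c″)
      complete : U l × Dist A′ (rk l) v x → Body
      complete (ul , d) with moved? v x
      ... | no ¬Sx = inj₁ (¬Sx , from level⇔ (uv , ul , Reroutes.kept (reroutes uv) ¬Sx d))
      ... | yes Sx with _ , _ , _ , c ← candidate-exists Sx d
        with _ , l′ , _ , _ , ul′ , eq , c′ ← candᴺ (rk<N ul) c
        with refl ← rk-injective ul′ ul eq = inj₂ (Sx , (_ , _ , _ , c′) , minimal)
        where
        minimal : ¬ (∃[ m ] (Oᴹ M m l × m ≢ l) × Some m)
        minimal (m , lt , _ , _ , _ , c) with _ , um , c ← to cand⇔ c =
          ℕ.<⇒≱ (to (<⇔ um ul) lt) (distLeast d (candidate-walk Sx c))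

    choice⇔ : ∀ {x p r} → S x → Holds M₃ Choice (v ∷ x ∷ p ∷ r ∷ []) ⇔ Best x p r
    choice⇔ {x} {p} {r} Sx = mk⇔ (sound ∘ to h) (from h ∘ complete)
      where
      h = holds-update choose a b M₂ Choice (v ∷ x ∷ p ∷ r ∷ [])
      Less : Fin n → Fin n → Set
      Less y z = Oᴹ M y z × y ≢ z
      Earlier : (p′ r′ j′ j : Fin n) → Set
      Earlier p′ r′ j′ j = Less j′ j ⊎ (j′ ≡ j × (Less p′ p ⊎ (p′ ≡ p × Less r′ r)))
      Better : Fin n → Fin n → Set
      Better j l = ∃[ p′ ] ∃[ r′ ] ∃[ j′ ] Candᴹ v x p′ r′ j′ l × Earlier p′ r′ j′ j
      Body : Set
      Body = ∃[ l ] ∃[ j ] Holds M₂ Level⁺ (v ∷ x ∷ l ∷ []) × Candᴹ v x p r j l × ¬ Better j l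
      bridged : ∀ {y z} → A′ y z → U y × U z
      bridged e = A′-used e , A′-used (A′-sym e)
      earlier⇔ : ∀ {p′ r′ j′ j} → U j′ → U j → A′ p′ r′ → A′ p r →
                 Earlier p′ r′ j′ j ⇔ Precedes (rk j′) p′ r′ (rk j) p r
      earlier⇔ {p′} {r′} {j′} {j} uj′ uj e′ e with up′ , ur′ ← bridged e′ | up , ur ← bridged e = mk⇔
        (Sum.map (to (<⇔ uj′ uj)) (λ (eq , q) → cong rk eq ,
          Sum.map (to (<⇔ up′ up)) (λ (eq , q) → cong rk eq , to (<⇔ ur′ ur) q) q))
        (Sum.map (from (<⇔ uj′ uj)) (λ (eq , q) → rk-injective uj′ uj eq ,
          Sum.map (from (<⇔ up′ up)) (λ (eq , q) → rk-injective up′ up eq , from (<⇔ ur′ ur) q) q))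
      sound : Body → Best x p r
      sound (l , j , ll , c , min) with ul , d ← to level⁺⇔ ll | uj , _ , c ← to cand⇔ c =
        best d c λ {p′} {r′} {j′} c′ prec →
          let j″ , l″ , uj″ , j≡ , ul″ , l≡ , c″ = candᴺ (rk<N ul) c′
              eq = rk-injective ul″ ul l≡
          in min (p′ , r′ , j″ , subst (Candᴹ v x p′ r′ j″) eq c″ ,
               from (earlier⇔ uj″ uj (Candidate.bridge c′) (Candidate.bridge c))
                 (subst (λ k → Precedes k p′ r′ (rk j) p r) (sym j≡) prec))
      complete : Best x p r → Body
      complete (best d c min)
        with j , l , uj , refl , ul , refl , cᴹ ← candᴺ (bounded (A′-used ∘ A′-sym) uv d) c =
        l , j , from level⁺⇔ (ul , d) , cᴹ , λ (p′ , r′ , j′ , c′ᴹ , prec) →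
          let uj′ , _ , c′ = to cand⇔ c′ᴹ in
          min c′ (to (earlier⇔ uj′ uj (Candidate.bridge c′) (Candidate.bridge c)) prec)

    anc⇔ : ∀ {x z} → Ancᴹ M₄ v x z ⇔ Anc′ x z
    anc⇔ {x} {z} = mk⇔ (sound ∘ to h) (from h ∘ complete)
      where
      h = holds-update commit a b M₃ Anc (v ∷ x ∷ z ∷ [])
      Body : Set
      Body = ((¬ S x) × Ancᴹ M v x z) ⊎
             (S x × (∃[ p ] ∃[ r ] Holds M₃ Choice (v ∷ x ∷ p ∷ r ∷ []) × (Ancᴹ M v p z ⊎ Ancᴹ M r x z)))
      sound : Body → Anc′ x z
      sound (inj₁ (¬Sx , q)) = old ¬Sx q
      sound (inj₂ (Sx , _ , _ , c , inj₁ q)) = upper Sx (to (choice⇔ Sx) c) q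
      sound (inj₂ (Sx , _ , _ , c , inj₂ q)) = lower Sx (to (choice⇔ Sx) c) q
      complete : Anc′ x z → Body
      complete (old ¬Sx q) = inj₁ (¬Sx , q)
      complete (upper Sx c q) = inj₂ (Sx , _ , _ , from (choice⇔ Sx) c , inj₁ q)
      complete (lower Sx c q) = inj₂ (Sx , _ , _ , from (choice⇔ Sx) c , inj₂ q)

    newAncestry : IsAncestry A′ v (Ancᴹ M₄ v)
    newAncestry = isAncestry-cong (from anc⇔) (to anc⇔) ancestry′

  rerouted : State M₄ rk N U U A′ N
  rerouted = record
    { ordered  = record { O⇔ = O⇔ ; rk<N = rk<N ; rk-injective = rk-injective ; rk-surjective = rk-surjective }
    ; old      = λ u → u
    ; edge⇔    = edge⇔
    ; A-sym    = A′-sym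
    ; A-used   = A′-used
    ; plus     = to plus⇔
    ; plus⁻    = λ ui uj ul eq _ → from plus⇔ (ui , uj , ul , eq)
    ; level    = λ l → let uv = level-used l in uv , to (level⁺⇔ uv) l
    ; level⁻   = λ uv ul d → from (level⁺⇔ uv) (ul , d)
    ; ancestry = newAncestry
    ; anc-used = λ {v} {x} {z} q → anc-used′ (to (holds-update commit a b M₃ Anc (v ∷ x ∷ z ∷ [])) q)
    }
    where
    level-used : ∀ {v x l} → Holds M₂ Level⁺ (v ∷ x ∷ l ∷ []) → U v
    level-used {v} {x} {l} q with to (holds-update measure a b M₁ Level⁺ (v ∷ x ∷ l ∷ [])) q
    ... | inj₁ (_ , p) = proj₁ (to level⇔ p)
    ... | inj₂ (Sx , _) = proj₁ (moved-used Sx)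
    anc-used′ : ∀ {v x z} → M₃ ⊨ commit Anc [ a ∷ b ∷ v ∷ x ∷ z ∷ [] ] → U v
    anc-used′ (inj₁ (_ , p)) = anc-used p
    anc-used′ (inj₂ (Sx , _)) = proj₁ (moved-used Sx)

-- The two request types and the vertices they move.

joinsᶠ : ∀ {k} → Fin k → Fin k → Fin k → Fin k → Formula τ k
joinsᶠ a b x y = ((x ≈ᶠ a) ∧ᶠ (y ≈ᶠ b)) ∨ᶠ ((x ≈ᶠ b) ∧ᶠ (y ≈ᶠ a))

-- The sum `i + j + 1` needs a vertex of its rank only below an old distance `m`, so a sum beyond
-- all ranks is handled correctly. Without an old distance the universal part is true.
nearᶠ : Fin 4 → Fin 4 → Formula τ 4
nearᶠ c d = ∃ᶠ ∃ᶠ (atom Level (4F ∷ (2 ↑ʳ c) ∷ 1F ∷ []) ∧ᶠ (atom Level ((2 ↑ʳ d) ∷ 5F ∷ 0F ∷ []) ∧ᶠ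
  (∀ᶠ ((¬ᶠ atom Level (5F ∷ 6F ∷ 0F ∷ [])) ∨ᶠ (∃ᶠ (atom Plus (3F ∷ 2F ∷ 0F ∷ []) ∧ᶠ (0F <ᶠ 1F)))))))

moveInsert : Update {τ}
moveInsert Edge  = atom Edge (2F ∷ 3F ∷ []) ∨ᶠ joinsᶠ 0F 1F 2F 3F
moveInsert Moved = nearᶠ 0F 1F ∨ᶠ nearᶠ 1F 0F
moveInsert R     = unchanged R

moveDelete : Update {τ}
moveDelete Edge  = atom Edge (2F ∷ 3F ∷ []) ∧ᶠ (¬ᶠ joinsᶠ 0F 1F 2F 3F)
moveDelete Moved = atom Edge (0F ∷ 1F ∷ []) ∧ᶠ (atom Anc (2F ∷ 3F ∷ 0F ∷ []) ∧ᶠ atom Anc (2F ∷ 3F ∷ 1F ∷ []))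
moveDelete R     = unchanged R

output : Update {τ}
output BFSEdge = (atom Anc (2F ∷ 3F ∷ 4F ∷ []) ∧ᶠ atom Edge (3F ∷ 4F ∷ [])) ∨ᶠ
                 (atom Anc (2F ∷ 4F ∷ 3F ∷ []) ∧ᶠ atom Edge (4F ∷ 3F ∷ []))
output Path    = (atom Anc (2F ∷ 3F ∷ 5F ∷ []) ∨ᶠ atom Anc (2F ∷ 4F ∷ 5F ∷ [])) ∧ᶠ
  (∀ᶠ ((¬ᶠ atom Anc (3F ∷ 4F ∷ 0F ∷ [])) ∨ᶠ ((¬ᶠ atom Anc (3F ∷ 5F ∷ 0F ∷ [])) ∨ᶠ atom Anc (3F ∷ 6F ∷ 0F ∷ []))))
output R       = unchanged R

reroute : Update {τ}
reroute = collect ⨾ measure ⨾ choose ⨾ commit ⨾ output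

-- Both ends are made used before `moveInsert`, which reads the distances from `a` and `b`; levels
-- are stored for used roots only.
program : Program τ
program insert = append 0F ⨾ append 1F ⨾ grow ⨾ grow ⨾ moveInsert ⨾ reroute
program delete = moveDelete ⨾ reroute

reroutes-cong : ∀ {V : Set} {A A′ : Rel V 0ℓ} {v : V} {S S′ : Pred V 0ℓ} {Anc : V → Rel V 0ℓ} →
                (∀ {x} → S x ⇔ S′ x) → Reroutes A A′ v S Anc → Reroutes A A′ v S′ Anc
reroutes-cong eq rr = record
  { root        = root ∘ from eq
  ; keep        = λ ¬s → keep (¬s ∘ to eq)
  ; kept        = λ ¬s → kept (¬s ∘ to eq)
  ; outside     = λ ¬s a → outside (¬s ∘ to eq) a ∘ from eq
  ; outsideEdge = λ ¬s → outsideEdge (¬s ∘ to eq)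
  ; inside      = λ s s′ → inside (from eq s) (from eq s′)
  ; insideEdge  = λ s s′ → insideEdge (from eq s) (from eq s′)
  }
  where open Reroutes rr

module _ {n} {M : Structure τ n} {rk N U A} (state : State M rk N U U A N) where

  open State state

  private
    reordered : ∀ {M′ : Structure τ n} → (∀ {x y} → Oᴹ M′ x y ⇔ Oᴹ M x y) → Ordered M′ rk N U
    reordered eq = record
      { O⇔ = ⇔.trans eq O⇔ ; rk<N = rk<N ; rk-injective = rk-injective ; rk-surjective = rk-surjective }

    plus⇔ : ∀ {i j l} → Plusᴹ M i j l ⇔ (U i × U j × U l × suc (rk i + rk j) ≡ rk l)
    plus⇔ = mk⇔ plus (λ (ui , uj , ul , eq) → plus⁻ ui uj ul eq (rk<N ul))

    level⇔ : ∀ {v x l} → Levelᴹ M v x l ⇔ (U v × U l × Dist A (rk l) v x)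
    level⇔ = mk⇔ level (λ (uv , ul , d) → level⁻ uv ul d)

    reached : ∀ {k v x} → U v → Dist A k v x → U x
    reached u d = walk-closed A-used′ u (distWalk d)

  deleted : ∀ {a b} → a ≢ b →
            Ready (apply-update moveDelete a b M) rk N U A (λ x y → A x y × ¬ Joins a b x y)
  deleted {a} {b} a≢b = record
    { ordered    = reordered ⇔.refl
    ; edge⇔      = λ {x} {y} → mk⇔ (λ p → let e , j = to (h x y) p in to edge⇔ e , j)
                                   (λ (e , j) → from (h x y) (from edge⇔ e , j))
    ; A?         = A?
    ; A-used     = A-used′
    ; A′-sym     = λ (e , j) → A-sym e , j ∘ joins-swap
    ; A′-used    = A-used ∘ proj₁
    ; plus⇔      = plus⇔
    ; level⇔     = level⇔
    ; ancestry   = ancestry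
    ; anc-used   = anc-used
    ; moved-used = λ m → let _ , p , _ = from moved⇔ m ; uv = anc-used p
                             _ , _ , _ , d = IsAncestry.below (ancestry uv) p in uv , reached uv d
    ; reroutes   = λ {v} uv → reroutes-cong moved⇔
        (Deletion.reroutes A? A-sym a≢b {Anc = Ancᴹ M} (ancestry uv)
          (λ (_ , p , _) → let _ , _ , _ , d = IsAncestry.below (ancestry uv) p in ancestry (reached uv d)))
    }
    where
    M′ = apply-update moveDelete a b M
    h : ∀ x y → Edgeᴹ M′ x y ⇔ (Edgeᴹ M x y × ¬ Joins a b x y)
    h x y = holds-update moveDelete a b M Edge (x ∷ y ∷ [])
    moved⇔ : ∀ {v x} → (A a b × Ancᴹ M v x a × Ancᴹ M v x b) ⇔ Movedᴹ M′ v x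
    moved⇔ {v} {x} = mk⇔ (λ (e , p) → from m (from edge⇔ e , p)) (λ q → let e , p = to m q in to edge⇔ e , p)
      where m = holds-update moveDelete a b M Moved (v ∷ x ∷ [])

  inserted : ∀ {a b} → U a → U b →
             Ready (apply-update moveInsert a b M) rk N U A (λ x y → A x y ⊎ Joins a b x y)
  inserted {a} {b} ua ub = record
    { ordered    = reordered ⇔.refl
    ; edge⇔      = λ {x} {y} → mk⇔ (Sum.map₁ (to edge⇔) ∘ to (h x y)) (from (h x y) ∘ Sum.map₁ (from edge⇔))
    ; A?         = A?
    ; A-used     = A-used′
    ; A′-sym     = Sum.map A-sym joins-swap
    ; A′-used    = λ { (inj₁ e) → A-used e ; (inj₂ (inj₁ (refl , _))) → ua ; (inj₂ (inj₂ (refl , _))) → ub }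
    ; plus⇔      = plus⇔
    ; level⇔     = level⇔
    ; ancestry   = ancestry
    ; anc-used   = anc-used
    ; moved-used = λ m → Sum.[ body-used , body-used ] (to moved⇔ m)
    ; reroutes   = λ {v} uv → reroutes-cong (mk⇔ (from moved⇔ ∘ complete uv) (sound ∘ to moved⇔))
        (Insertion.reroutes A? {Anc = Ancᴹ M} (reachable? uv) (ancestry uv))
    }
    where
    M′ = apply-update moveInsert a b M
    h : ∀ x y → Edgeᴹ M′ x y ⇔ (Edgeᴹ M x y ⊎ Joins a b x y)
    h x y = holds-update moveInsert a b M Edge (x ∷ y ∷ [])

    reachable? : ∀ {v} → U v → ∀ x → Dec (∃[ k ] Dist A k v x)
    reachable? {v} uv x = map′ (λ (l , p) → rk l , proj₂ (proj₂ (level p)))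
      (λ (k , d) → let l , ul , eq = rk-surjective (bounded A-used′ uv d) in
                   l , level⁻ uv ul (dist-≡ (sym eq) d))
      (any? λ l → T? (⟦ M ⟧ Level (v ∷ x ∷ l ∷ [])))

    Body : (v x c d : Fin n) → Set
    Body v x c d = ∃[ i ] ∃[ j ] Levelᴹ M v c i × Levelᴹ M d x j ×
      (∀ m → (¬ Levelᴹ M v x m) ⊎ (∃[ l ] Plusᴹ M i j l × (Oᴹ M l m × l ≢ m)))

    moved⇔ : ∀ {v x} → Movedᴹ M′ v x ⇔ (Body v x a b ⊎ Body v x b a)
    moved⇔ {v} {x} = holds-update moveInsert a b M Moved (v ∷ x ∷ [])

    body-used : ∀ {v x c d} → Body v x c d → U v × U x
    body-used (_ , _ , p , q , _) with ud , _ , dx ← level q = proj₁ (level p) , reached ud dx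

    body⇒near : ∀ {v x c d} → Body v x c d → Near A v c d x
    body⇒near {v} {x} (i , j , p , q , f) with uv , _ , di ← level p | _ , _ , dj ← level q = near di dj less
      where
      less : ∀ {m} → Dist A m v x → suc (rk i + rk j) < m
      less d with m , um , refl ← rk-surjective (bounded A-used′ uv d) with f m
      ... | inj₁ ¬l = contradiction (level⁻ uv um d) ¬l
      ... | inj₂ (l , s , lt) with _ , _ , ul , eq ← plus s = subst (_< rk m) (sym eq) (to (<⇔ ul um) lt)

    near⇒body : ∀ {v x c d} → U v → U d → Near A v c d x → Body v x c d
    near⇒body {v} {x} uv ud (near di dj less)
      with i , ui , refl ← rk-surjective (bounded A-used′ uv di)
         | j , uj , refl ← rk-surjective (bounded A-used′ ud dj) =
      i , j , level⁻ uv ui di , level⁻ ud uj dj , above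
      where
      above : ∀ m → (¬ Levelᴹ M v x m) ⊎ (∃[ l ] Plusᴹ M i j l × (Oᴹ M l m × l ≢ m))
      above m with T? (⟦ M ⟧ Level (v ∷ x ∷ m ∷ []))
      ... | no ¬p = inj₁ ¬p
      ... | yes p with _ , um , d ← level p with lt ← less d
        with l , ul , eq ← rk-surjective (ℕ.<-trans lt (rk<N um)) =
        inj₂ (l , plus⁻ ui uj ul (sym eq) (rk<N ul) , from (<⇔ ul um) (subst (_< rk m) (sym eq) lt))

    sound : ∀ {v x} → Body v x a b ⊎ Body v x b a → Shortened A a b v x
    sound (inj₁ p) = a , b , inj₁ (refl , refl) , body⇒near p
    sound (inj₂ p) = b , a , inj₂ (refl , refl) , body⇒near p

    complete : ∀ {v x} → U v → Shortened A a b v x → Body v x a b ⊎ Body v x b a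
    complete uv (_ , _ , inj₁ (refl , refl) , p) = inj₁ (near⇒body uv ub p)
    complete uv (_ , _ , inj₂ (refl , refl) , p) = inj₂ (near⇒body uv ua p)

-- The invariant.

record Agree {n} (M M′ : Structure τ n) : Set where
  field
    edge  : ∀ {x y} → Edgeᴹ M x y ⇔ Edgeᴹ M′ x y
    order : ∀ {x y} → Oᴹ M x y ⇔ Oᴹ M′ x y
    plus  : ∀ {x y z} → Plusᴹ M x y z ⇔ Plusᴹ M′ x y z
    level : ∀ {x y z} → Levelᴹ M x y z ⇔ Levelᴹ M′ x y z
    anc   : ∀ {x y z} → Ancᴹ M x y z ⇔ Ancᴹ M′ x y z

module _ {n} {M : Structure τ n} {rk : Fin n → ℕ} {N : ℕ} {U : Pred (Fin n) 0ℓ} {A : Rel (Fin n) 0ℓ} where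

  state-cong : ∀ {M′ U′} → Agree M M′ → (∀ {x} → U x ⇔ U′ x) →
               State M rk N U U A N → State M′ rk N U′ U′ A N
  state-cong agree U⇔ state = record
    { ordered  = record
      { O⇔            = mk⇔ (λ o → let ux , uy , le = to O⇔ (from E.order o) in to U⇔ ux , to U⇔ uy , le)
                            (λ (ux , uy , le) → to E.order (from O⇔ (from U⇔ ux , from U⇔ uy , le)))
      ; rk<N          = rk<N ∘ from U⇔
      ; rk-injective  = λ ux uy → rk-injective (from U⇔ ux) (from U⇔ uy)
      ; rk-surjective = λ k<N → let x , ux , eq = rk-surjective k<N in x , to U⇔ ux , eq
      }
    ; old      = λ u → u
    ; edge⇔    = ⇔.trans (⇔.sym E.edge) edge⇔
    ; A-sym    = A-sym
    ; A-used   = to U⇔ ∘ A-used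
    ; plus     = λ p → let ui , uj , ul , eq = plus (from E.plus p) in to U⇔ ui , to U⇔ uj , to U⇔ ul , eq
    ; plus⁻    = λ ui uj ul eq lt → to E.plus (plus⁻ (from U⇔ ui) (from U⇔ uj) (from U⇔ ul) eq lt)
    ; level    = λ p → let uv , ul , d = level (from E.level p) in to U⇔ uv , to U⇔ ul , d
    ; level⁻   = λ uv ul d → to E.level (level⁻ (from U⇔ uv) (from U⇔ ul) d)
    ; ancestry = λ uv → isAncestry-cong (to E.anc) (from E.anc) (ancestry (from U⇔ uv))
    ; anc-used = to U⇔ ∘ anc-used ∘ from E.anc
    }
    where
    open State state
    module E = Agree agree

state-lower : ∀ {n} {M : Structure τ n} {rk N U₀ U A K K′} → K′ ≤ K →
              State M rk N U₀ U A K → State M rk N U₀ U A K′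
state-lower K′≤K state = record
  { ordered = ordered ; old = old ; edge⇔ = edge⇔ ; A-sym = A-sym ; A-used = A-used ; plus = plus
  ; plus⁻ = λ ui uj ul eq lt → plus⁻ ui uj ul eq (ℕ.<-≤-trans lt K′≤K)
  ; level = level ; level⁻ = level⁻ ; ancestry = ancestry ; anc-used = anc-used }
  where open State state

record Invariant {n} (M : Structure τ n) (U : Pred (Fin n) 0ℓ) (A : Rel (Fin n) 0ℓ) : Set where
  field
    {rk}     : Fin n → ℕ
    {N}      : ℕ
    state    : State M rk N U U A N
    bfsEdge⇔ : ∀ {v x y} → Holds M BFSEdge (v ∷ x ∷ y ∷ []) ⇔
               ((Ancᴹ M v x y × A x y) ⊎ (Ancᴹ M v y x × A y x))
    path⇔    : ∀ {v x y z} → Holds M Path (v ∷ x ∷ y ∷ z ∷ []) ⇔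
               ((Ancᴹ M v x z ⊎ Ancᴹ M v y z) × (∀ w → Ancᴹ M v x w → Ancᴹ M v y w → Ancᴹ M v z w))

invariant-cong : ∀ {n} {M M′ : Structure τ n} {U U′ : Pred (Fin n) 0ℓ} {A} →
                 (∀ R xs → Holds M′ R xs ⇔ Holds M R xs) → (∀ {x} → U x ⇔ U′ x) →
                 Invariant M U A → Invariant M′ U′ A
invariant-cong {M = M} {M′} eq U⇔ inv = record
  { state    = state-cong agree U⇔ state
  ; bfsEdge⇔ = ⇔.trans (eq BFSEdge _) (⇔.trans bfsEdge⇔
      (mk⇔ (Sum.map (λ (p , e) → to a p , e) (λ (p , e) → to a p , e))
           (Sum.map (λ (p , e) → from a p , e) (λ (p , e) → from a p , e))))
  ; path⇔    = ⇔.trans (eq Path _) (⇔.trans path⇔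
      (mk⇔ (λ (s , t) → Sum.map (to a) (to a) s , λ w p q → to a (t w (from a p) (from a q)))
           (λ (s , t) → Sum.map (from a) (from a) s , λ w p q → from a (t w (to a p) (to a q)))))
  }
  where
  open Invariant inv
  agree : Agree M M′
  agree = record { edge  = ⇔.sym (eq Edge _) ; order = ⇔.sym (eq O _) ; plus = ⇔.sym (eq Plus _)
                 ; level = ⇔.sym (eq Level _) ; anc = ⇔.sym (eq Anc _) }
  a : ∀ {v x z} → Ancᴹ M v x z ⇔ Ancᴹ M′ v x z
  a = Agree.anc agree

outputInvariant : ∀ {n} {M : Structure τ n} {rk N U A} (a b : Fin n) → State M rk N U U A N →
                  Invariant (apply-update output a b M) U A
outputInvariant {M = M} a b state = record
  { state    = state-cong
      record { edge = ⇔.refl ; order = ⇔.refl ; plus = ⇔.refl ; level = ⇔.refl ; anc = ⇔.refl } ⇔.refl state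
  ; bfsEdge⇔ = λ {v} {x} {y} → ⇔.trans (holds-update output a b M BFSEdge (v ∷ x ∷ y ∷ []))
      (mk⇔ (Sum.map (λ (p , e) → p , to edge⇔ e) (λ (p , e) → p , to edge⇔ e))
           (Sum.map (λ (p , e) → p , from edge⇔ e) (λ (p , e) → p , from edge⇔ e)))
  ; path⇔    = λ {v} {x} {y} {z} → ⇔.trans (holds-update output a b M Path (v ∷ x ∷ y ∷ z ∷ []))
      (mk⇔ (λ (s , t) → s , λ w p q → Sum.[ contradiction p , Sum.[ contradiction q , (λ r → r) ] ] (t w))
           (λ (s , t) → s , λ w → weaken (T? (⟦ M ⟧ Anc (v ∷ x ∷ w ∷ []))) (T? (⟦ M ⟧ Anc (v ∷ y ∷ w ∷ []))) (t w)))
  }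
  where
  open State state
  weaken : ∀ {P Q R : Set} → Dec P → Dec Q → (P → Q → R) → (¬ P) ⊎ ((¬ Q) ⊎ R)
  weaken (no ¬p) _       _ = inj₁ ¬p
  weaken (yes _) (no ¬q) _ = inj₂ (inj₁ ¬q)
  weaken (yes p) (yes q) f = inj₂ (inj₂ (f p q))

-- Comparing the composed update with the structure reached stage by stage lets each stage be
-- verified by itself.
record Runs {n} (σ : Update {τ}) (a b : Fin n) (M M′ : Structure τ n) : Set where
  constructor runs
  field agrees : ∀ R xs → Holds (apply-update σ a b M) R xs ⇔ Holds M′ R xs

module _ {n} {a b : Fin n} where

  once : ∀ {σ M} → Runs σ a b M (apply-update σ a b M)
  once = runs λ _ _ → ⇔.refl

  _then_ : ∀ {θ M M′} σ → Runs θ a b (apply-update σ a b M) M′ → Runs (σ ⨾ θ) a b M M′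
  _then_ {θ} {M} σ (runs r) = runs λ R xs → ⇔.trans (holds-⨾ σ θ a b M R xs) (r R xs)

  infixr 5 _then_

invariant : ∀ {n} (rs : History n) → Invariant (run program rs) (Used rs) (Adj (graph rs))
invariant [] = record
  { rk = λ _ → 0 ; N = 0
  ; state = record
    { ordered = record { O⇔ = mk⇔ (λ ()) (λ { (() , _) }) ; rk<N = λ ()
                       ; rk-injective = λ () ; rk-surjective = λ () }
    ; old = λ () ; edge⇔ = mk⇔ (λ ()) (λ ()) ; A-sym = λ () ; A-used = λ () ; plus = λ () ; plus⁻ = λ ()
    ; level = λ () ; level⁻ = λ () ; ancestry = λ () ; anc-used = λ () }
  ; bfsEdge⇔ = mk⇔ (λ ()) (λ { (inj₁ (() , _)) ; (inj₂ (() , _)) })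
  ; path⇔ = mk⇔ (λ ()) (λ { (inj₁ () , _) ; (inj₂ () , _) })
  }
invariant (request insert a b a≢b ∷ rs)
  with inv ← invariant rs with s₀ ← Invariant.state inv
  with _ , _ , N≤N₁ , N₁≤ , s₁ ← appended s₀ a b 0F ℕ.≤-refl
  with _ , _ , N₁≤N₂ , N₂≤ , s₂ ← appended s₁ a b 1F N≤N₁
  -- Two applications of `grow` complete `Plus` below the old number of used vertices plus two,
  -- which is at least the new number.
  with s₃ ← state-lower (ℕ.≤-trans N₂≤ (s≤s N₁≤)) (grown (grown s₂ a b) a b) =
  invariant-cong (Runs.agrees chain) (mk⇔ used unused)
    (outputInvariant a b (rerouted (inserted s₃ (inj₁ (inj₂ refl)) (inj₂ refl)) a b))
  where
  chain = append 0F then append 1F then grow then grow then moveInsert then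
          collect then measure then choose then commit then once {σ = output}
  used : ∀ {x} → (Used rs x ⊎ x ≡ a) ⊎ x ≡ b → Used (request insert a b a≢b ∷ rs) x
  used (inj₁ (inj₁ u)) = there u
  used (inj₁ (inj₂ p)) = here (inj₁ p)
  used (inj₂ p)        = here (inj₂ p)
  unused : ∀ {x} → Used (request insert a b a≢b ∷ rs) x → (Used rs x ⊎ x ≡ a) ⊎ x ≡ b
  unused (there u)       = inj₁ (inj₁ u)
  unused (here (inj₁ p)) = inj₁ (inj₂ p)
  unused (here (inj₂ p)) = inj₂ p
invariant (request delete a b a≢b ∷ rs) with inv ← invariant rs =
  invariant-cong (Runs.agrees chain) (mk⇔ there λ { (here ()) ; (there u) → u })
    (outputInvariant a b (rerouted (deleted (Invariant.state inv) a≢b) a b))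
  where
  chain = moveDelete then collect then measure then choose then commit then once {σ = output}

-- Ranks by counting, and definable distances.

lookup-injective : ∀ {X : Set} {xs : List X} → Unique xs → ∀ i j → List.lookup xs i ≡ List.lookup xs j → i ≡ j
lookup-injective (_ ∷ _)  zero    zero    _  = refl
lookup-injective (x≢ ∷ _) zero    (suc j) eq = contradiction eq (All.lookup x≢ (∈-lookup j))
lookup-injective (x≢ ∷ _) (suc i) zero    eq = contradiction (sym eq) (All.lookup x≢ (∈-lookup i))
lookup-injective (_ ∷ u)  (suc i) (suc j) eq = cong suc (lookup-injective u i j eq)

-- `rk` embeds the positions of the list into the numbers below `k`, and surjectivity yields an
-- embedding back, so the sizes agree. This identifies `rank` with the internal `rk`.
count : ∀ {n} {P : Pred (Fin n) 0ℓ} (P? : U.Decidable P) (rk : Fin n → ℕ) {k} →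
        (∀ {x} → P x → rk x < k) → (∀ {x y} → P x → P y → rk x ≡ rk y → x ≡ y) →
        (∀ {i} → i < k → ∃[ x ] P x × rk x ≡ i) →
        List.length (filter P? (allFin n)) ≡ k
count {n} {P} P? rk {k} rk< injective surjective =
  Fin.cantor-schröder-bernstein {f = code} {g = place} code-injective place-injective
  where
  xs = filter P? (allFin n)
  holds : ∀ i → P (List.lookup xs i)
  holds i = proj₂ (∈-filter⁻ P? {xs = allFin n} (∈-lookup i))
  member : ∀ i → ∃[ x ] x ∈ xs × rk x ≡ toℕ i
  member i with x , p , eq ← surjective (Fin.toℕ<n {k} i) = x , ∈-filter⁺ P? (∈-allFin x) p , eq
  code : Fin (List.length xs) → Fin k
  code i = fromℕ< (rk< (holds i))
  code-injective : ∀ {i j} → code i ≡ code j → i ≡ j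
  code-injective {i} {j} eq = lookup-injective (Unique.filter⁺ P? (Unique.allFin⁺ n)) i j
    (injective (holds i) (holds j)
      (trans (sym (Fin.toℕ-fromℕ< (rk< (holds i)))) (trans (cong toℕ eq) (Fin.toℕ-fromℕ< (rk< (holds j))))))
  place : Fin k → Fin (List.length xs)
  place i = Any.index (proj₁ (proj₂ (member i)))
  place-injective : ∀ {i j} → place i ≡ place j → i ≡ j
  place-injective {i} {j} eq = Fin.toℕ-injective (trans (sym (ranked i)) (trans (cong rk same) (ranked j)))
    where
    ranked : ∀ i → rk (proj₁ (member i)) ≡ toℕ i
    ranked i = proj₂ (proj₂ (member i))
    located : ∀ i → proj₁ (member i) ≡ List.lookup xs (place i)
    located i = Any.lookup-index (proj₁ (proj₂ (member i)))
    same : proj₁ (member i) ≡ proj₁ (member j)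
    same = trans (located i) (trans (cong (List.lookup xs) eq) (sym (located j)))

distᶠ : Fin 3 → Fin 3 → Formula τ 3
distᶠ x y = usedᶠ 2F ∧ᶠ (atom Level (x ∷ y ∷ 2F ∷ []) ∨ᶠ ((x ≈ᶠ y) ∧ᶠ leastᶠ 2F))

module _ {n : ℕ} (rs : History n) where

  private
    M = run program rs
    G = graph rs

  open Invariant (invariant rs)
  open State state

  private
    reach : ∀ {k x y} → Walk (Adj G) k x y → ∃[ j ] Dist (Adj G) j x y × j ≤ k
    reach = shortest A?

  rank≡rk : ∀ {l} → Used rs l → rank M rs l ≡ rk l
  rank≡rk {l} ul = count _ rk
    (λ (ux , o , x≢l) → to (<⇔ ux ul) (o , x≢l))
    (λ (ux , _) (uy , _) → rk-injective ux uy)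
    (λ i< → let x , ux , eq = rk-surjective (ℕ.<-trans i< (rk<N ul))
                o , x≢l = from (<⇔ ux ul) (subst (_< rk l) (sym eq) i<) in x , (ux , o , x≢l) , eq)

  dist⇔ : ∀ {l x y} → Used rs l → Dist (Adj G) (rk l) x y ⇔ IsDistance G x y (rank M rs l)
  dist⇔ {l} {x} {y} ul = subst (λ k → Dist (Adj G) (rk l) x y ⇔ IsDistance G x y k) (sym (rank≡rk ul))
    (mk⇔ (dist⇒isDistance reach) (isDistance⇒dist reach))

  maintains : MaintainsBFS M rs
  maintains = record
    { edge  = λ _ _ → edge⇔
    ; order = record
      { onUsed       = λ o → let ux , uy , _ = to O⇔ o in ux , uy
      ; isTotalOrder = record
        { isPartialOrder = record
          { isPreorder = record
            { isEquivalence = record { refl = refl ; sym = sym ; trans = trans }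
            ; reflexive     = λ { {_ , u} refl → from used⇔ u }
            ; trans         = λ p q → let ux , _ , le = to O⇔ p ; _ , uz , le′ = to O⇔ q in
                                      from O⇔ (ux , uz , ℕ.≤-trans le le′)
            }
          ; antisym = λ p q → let ux , uy , le = to O⇔ p ; _ , _ , le′ = to O⇔ q in
                              rk-injective ux uy (ℕ.≤-antisym le le′)
          }
        ; total = λ (x , ux) (y , uy) →
            Sum.map (λ le → from O⇔ (ux , uy , le)) (λ le → from O⇔ (uy , ux , le)) (ℕ.≤-total (rk x) (rk y))
        }
      }
    ; level = λ uv ux ul → mk⇔
        (λ p → let _ , _ , d = level p in dist⇒connected reach d , to (dist⇔ ul) d)
        (λ (_ , d) → level⁻ uv ul (from (dist⇔ ul) d))
    ; tree  = λ {v} uv → let module T = BFSTree G A? v (λ x z → T? (⟦ M ⟧ Anc (v ∷ x ∷ z ∷ []))) (ancestry uv) in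
        T.tree , T.isBFSTree , (λ _ _ → bfsEdge⇔) , λ tx ty _ → ⇔.trans path⇔ (T.onPath⇔ tx ty)
    }

  distᶠ⇔ : ∀ (ρ : Vec (Fin n) 3) x y → let l = Vec.lookup ρ 2F in
           M ⊨ distᶠ x y [ ρ ] ⇔ (Used rs l × IsDistance G (Vec.lookup ρ x) (Vec.lookup ρ y) (rank M rs l))
  distᶠ⇔ ρ@(_ ∷ _ ∷ l ∷ []) i j = mk⇔ sound complete
    where
    x = Vec.lookup ρ i
    y = Vec.lookup ρ j
    distance : Levelᴹ M x y l ⊎ (x ≡ y × M ⊨ leastᶠ 2F [ ρ ]) → Dist (Adj G) (rk l) x y
    distance (inj₁ p) = proj₂ (proj₂ (level p))
    distance (inj₂ (eq , p)) = subst (Dist (Adj G) (rk l) x) eq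
      (dist-≡ (sym (proj₂ (to (least⇔ ρ 2F) p))) dist-refl)
    sound : M ⊨ distᶠ i j [ ρ ] → Used rs l × IsDistance G x y (rank M rs l)
    sound (o , p) = to used⇔ o , to (dist⇔ (to used⇔ o)) (distance p)
    complete : Used rs l × IsDistance G x y (rank M rs l) → M ⊨ distᶠ i j [ ρ ]
    complete (ul , q) = from used⇔ ul , located (U? x) (from (dist⇔ ul) q)
      where
      located : Dec (Used rs x) → Dist (Adj G) (rk l) x y → Levelᴹ M x y l ⊎ (x ≡ y × M ⊨ leastᶠ 2F [ ρ ])
      located (yes ux) d = inj₁ (level⁻ ux ul d)
      located (no ¬ux) d with rk l in l≡ | d
      ... | zero  | d′ = inj₂ (dist-zero d′ , from (least⇔ ρ 2F) (ul , l≡))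
      ... | suc _ | dist (step e _) _ = contradiction (A-used e) ¬ux

theorem3 :
    Σ[ aux ∈ List ℕ ] Σ[ P ∈ Program (bfsVocabulary aux) ]
      (∀ (n : ℕ) (rs : History n) → MaintainsBFS (run P rs) rs) ×
      (Σ[ dist ∈ Formula (bfsVocabulary aux) 3 ]
        ∀ (n : ℕ) (rs : History n) → DefinesDistance (run P rs) rs dist) ×
      (Σ[ sphere ∈ Formula (bfsVocabulary aux) 3 ]
        ∀ (n : ℕ) (rs : History n) → DefinesSphere (run P rs) rs sphere)
theorem3 = auxiliaries , program , (λ _ → maintains) ,
  (distᶠ 0F 1F , λ _ rs x y l → distᶠ⇔ rs (x ∷ y ∷ l ∷ []) 0F 1F) ,
  -- The sphere formula lists the vertex before the centre, so the arguments are exchanged.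
  (distᶠ 1F 0F , λ _ rs v {l} ul →
    (λ {x} p → proj₂ (to (distᶠ⇔ rs (x ∷ v ∷ l ∷ []) 1F 0F) p)) ,
    (λ {x} d → from (distᶠ⇔ rs (x ∷ v ∷ l ∷ []) 1F 0F) (ul , d)))
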